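{- Let $T$ be a finite tree. Then $T \in \mathcal{T}$ if and only if $T$ has a $(\gamma_t-\tau)$-set, where $\mathcal{T}$ is the family of trees constructed from the path $P_4$ by the operations $\mathcal{O}_1,\mathcal{O}_2,\mathcal{O}_3,\mathcal{O}_4$ defined in the context.
   Context: All graphs are finite, undirected, simple and connected. $N(v)$ is the set of neighbors of $v$ (so $v\notin N(v)$). $P_n$ is the path with $n$ vertices. An end vertex (leaf) is a vertex of degree 1; a support vertex is a neighbor of an end vertex. A vertex cover of $G=(V,E)$ is a set $X\subseteq V$ such that each edge is incident to at least one vertex of $X$; $\tau(G)$ is the minimum cardinality of a vertex cover, and a $\tau(G)$-set is a vertex cover of cardinality $\tau(G)$. A total dominating set of $G$ is a dominating set $D\subseteq V$ such that the subgraph induced by $D$ has no isolated vertices (equivalently, every vertex of $G$ has a neighbor in $D$); $\gamma_t(G)$ is the minimum cardinality of a total dominating set (defined for graphs without isolated vertices), and a $\gamma_t(G)$-set is a total dominating set of cardinality $\gamma_t(G)$. A $(\gamma_t-\tau)$-set of $G$ is a set that is both a $\gamma_t(G)$-set and a $\tau(G)$-set. For $S\subseteq V$ and $v\in S$, $\mathrm{pn}(v,S)=\{u\in V : N(u)\cap S=\{v\}\}$. For a $\gamma_t(G)$-set $S$, a vertex $v$ is $S$-quasi-isolated if there is $u\in S$ with $\mathrm{pn}(u,S)=\{v\}$; $v$ is quasi-isolated (in $G$) if it is $S$-quasi-isolated for some $\gamma_t(G)$-set $S$. For disjoint graphs $G,H$ with $u\in V(G)$, $v\in V(H)$, the sum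 of $G$ with $H$ via the edge $uv$, $G+_{uv}H$, has vertex set $V(G)\cup V(H)$ and edge set $E(G)\cup E(H)\cup\{uv\}$. Operations on a tree $T$: - $\mathcal{O}_1$: choose $u\in V(T)$ belonging to some $(\gamma_t-\tau)$-set of $T$; let $v$ be a leaf of a (disjoint) path $P_4$; form $T+_{uv}P_4$. - $\mathcal{O}_2$: choose $u\in V(T)$ belonging to some $(\gamma_t-\tau)$-set of $T$; add a new vertex $v$ adjacent exactly to $u$. - $\mathcal{O}_3$: choose $u\in V(T)$ belonging to some $(\gamma_t-\tau)$-set of $T$ and such that $u$ is not quasi-isolated in $T$; let $P_2=(v,w)$ be a (disjoint) path with two vertices; form $T+_{uv}P_2$. - $\mathcal{O}_4$: choose $u\in V(T)$ that is not quasi-isolated in $T$; let $v$ be a support vertex of a (disjoint) path $P_4$; form $T+_{uv}P_4$. The family $\mathcal{T}$ consists of all trees $T$ (up to isomorphism) for which there is a sequence $T_1,\dots,T_k$ ($k\ge 1$) of trees such that $T_1=P_4$, $T_k=T$, and, if $k\ge 2$, each $T_{i+1}$ is obtained from $T_i$ by one of the operations $\mathcal{O}_1,\mathcal{O}_2,\mathcal{O}_3,\mathcal{O}_4$. -}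

module Defs where

open import Data.Fin using (Fin; zero; suc; toℕ; fromℕ; inject₁; splitAt; _≟_)
open import Data.Fin.Subset using (Subset; _∈_; _∩_; ⁅_⁆; ∣_∣)
open import Data.Nat as ℕ using (ℕ; _+_; _≤_; NonZero)
open import Data.Nat.Properties using (1+n≢n)
open import Data.Product using (∃-syntax; _×_; _,_)
open import Data.Sum using (_⊎_; inj₁; inj₂; swap)
open import Data.Vec using (tabulate)
open import Function.Bundles using (_⇔_; _↔_; Inverse)
open import Function.Definitions using (Injective)
import Level
open import Level using (0ℓ)
open import Relation.Binary.Construct.Closure.ReflexiveTransitive using (Star)
open import Relation.Binary.Core using (Rel)
open import Relation.Binary.Definitions
  using (Decidable; Irreflexive; Symmetric)
open import Relation.Binary.PropositionalEquality using (_≡_; refl; sym)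
open import Relation.Nullary using (¬_; does; _⊎-dec_; _×-dec_)
open import Relation.Nullary.Decidable using (map′)
open import Relation.Unary using (Pred; _≐_; ｛_｝)

record Graph : Set₁ where
  field
    order  : ℕ
    Adj    : Rel (Fin order) 0ℓ
    adj?   : Decidable Adj
    irrefl : Irreflexive _≡_ Adj
    symm   : Symmetric Adj

  Vertex : Set
  Vertex = Fin order

  N : Vertex → Subset order
  N v = tabulate (λ u → does (adj? v u))

  degree : Vertex → ℕ
  degree v = ∣ N v ∣

  IsLeaf : Pred Vertex 0ℓ
  IsLeaf v = degree v ≡ 1

  IsSupport : Pred Vertex 0ℓ
  IsSupport v = ∃[ u ] Adj v u × IsLeaf u

  Connected : Set
  Connected = ∀ u v → Star Adj u v

  -- A cycle of length 3 + k.
  record Cycle : Set where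
    field
      k         : ℕ
      vertex    : Fin (3 + k) → Vertex
      injective : Injective _≡_ _≡_ vertex
      step      : ∀ i → Adj (vertex (inject₁ i)) (vertex (suc i))
      close     : Adj (vertex (fromℕ (2 + k))) (vertex zero)

open Graph public using (Vertex)

record IsTree (G : Graph) : Set where
  open Graph G
  field
    nonempty  : NonZero order
    connected : Connected
    acyclic   : ¬ Cycle

record Tree : Set₁ where
  field
    graph  : Graph
    isTree : IsTree graph

open Tree public using (graph)

record _≅_ (G H : Graph) : Set where
  field
    bijection : Vertex G ↔ Vertex H
  open Inverse bijection using (to)
  field
    adj⇔ : ∀ u v → Graph.Adj G u v ⇔ Graph.Adj H (to u) (to v)

infix 4 _≅_

P : ℕ → Graph
P n = record
  { order  = n
  ; Adj    = λ i j → toℕ j ≡ ℕ.suc (toℕ i) ⊎ toℕ i ≡ ℕ.suc (toℕ j)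
  ; adj?   = λ i j →
      (toℕ j ℕ.≟ ℕ.suc (toℕ i)) ⊎-dec (toℕ i ℕ.≟ ℕ.suc (toℕ j))
  ; irrefl = λ { refl (inj₁ e) → 1+n≢n (sym e)
               ; refl (inj₂ e) → 1+n≢n (sym e) }
  ; symm   = swap
  }

module _ (G H : Graph) (u : Vertex G) (v : Vertex H) where
  private
    module G = Graph G
    module H = Graph H

  data SumAdj : Rel (Vertex G ⊎ Vertex H) 0ℓ where
    left    : ∀ {x y} → G.Adj x y → SumAdj (inj₁ x) (inj₁ y)
    right   : ∀ {x y} → H.Adj x y → SumAdj (inj₂ x) (inj₂ y)
    bridge  : SumAdj (inj₁ u) (inj₂ v)
    bridge′ : SumAdj (inj₂ v) (inj₁ u)

  sumAdj? : Decidable SumAdj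
  sumAdj? (inj₁ x) (inj₁ y) = map′ left (λ { (left e) → e }) (G.adj? x y)
  sumAdj? (inj₂ x) (inj₂ y) = map′ right (λ { (right e) → e }) (H.adj? x y)
  sumAdj? (inj₁ x) (inj₂ y) =
    map′ (λ { (refl , refl) → bridge }) (λ { bridge → refl , refl })
         ((x ≟ u) ×-dec (y ≟ v))
  sumAdj? (inj₂ x) (inj₁ y) =
    map′ (λ { (refl , refl) → bridge′ }) (λ { bridge′ → refl , refl })
         ((x ≟ v) ×-dec (y ≟ u))

  sumIrrefl : ∀ {x} → ¬ SumAdj x x
  sumIrrefl (left e)  = G.irrefl refl e
  sumIrrefl (right e) = H.irrefl refl e

  sumSym : Symmetric SumAdj
  sumSym (left e)  = left (G.symm e)
  sumSym (right e) = right (H.symm e)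
  sumSym bridge    = bridge′
  sumSym bridge′   = bridge

sumVia : (G H : Graph) → Vertex G → Vertex H → Graph
sumVia G H u v = record
  { order  = G.order + H.order
  ; Adj    = λ x y → SumAdj G H u v (splitAt G.order x) (splitAt G.order y)
  ; adj?   = λ x y → sumAdj? G H u v (splitAt G.order x) (splitAt G.order y)
  ; irrefl = λ { refl → sumIrrefl G H u v }
  ; symm   = sumSym G H u v
  }
  where
    module G = Graph G
    module H = Graph H

syntax sumVia G H u v = G +[ u , v ] H

IsMinimumSize : ∀ {n} → Pred (Subset n) 0ℓ → Pred ℕ 0ℓ
IsMinimumSize Q k = (∃[ S ] Q S × ∣ S ∣ ≡ k) × (∀ S → Q S → k ≤ ∣ S ∣)

module _ (G : Graph) where
  open Graph G hiding (Vertex)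

  IsVertexCover : Pred (Subset order) 0ℓ
  IsVertexCover X = ∀ u v → Adj u v → u ∈ X ⊎ v ∈ X

  IsDominating : Pred (Subset order) 0ℓ
  IsDominating D = ∀ v → v ∈ D ⊎ (∃[ u ] u ∈ D × Adj v u)

  IsTotalDominating : Pred (Subset order) 0ℓ
  IsTotalDominating D =
    IsDominating D × (∀ v → v ∈ D → ∃[ u ] u ∈ D × Adj v u)

  -- Isτ k and Isγₜ k say τ(G) = k and γₜ(G) = k.  They are relations because
  -- γₜ(G) is undefined when G has an isolated vertex.
  Isτ : Pred ℕ 0ℓ
  Isτ = IsMinimumSize IsVertexCover

  Isγₜ : Pred ℕ 0ℓ
  Isγₜ = IsMinimumSize IsTotalDominating

  IsτSet : Pred (Subset order) 0ℓ
  IsτSet X = IsVertexCover X × Isτ ∣ X ∣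

  IsγₜSet : Pred (Subset order) 0ℓ
  IsγₜSet D = IsTotalDominating D × Isγₜ ∣ D ∣

  Isγₜ-τSet : Pred (Subset order) 0ℓ
  Isγₜ-τSet S = IsγₜSet S × IsτSet S

  InSomeγₜ-τSet : Pred (Vertex G) 0ℓ
  InSomeγₜ-τSet u = ∃[ S ] Isγₜ-τSet S × u ∈ S

  pn : Vertex G → Subset order → Pred (Vertex G) 0ℓ
  pn v S u = N u ∩ S ≡ ⁅ v ⁆

  IsQuasiIsolatedBy : Subset order → Pred (Vertex G) 0ℓ
  IsQuasiIsolatedBy S v = ∃[ u ] u ∈ S × pn u S ≐ ｛ v ｝

  IsQuasiIsolated : Pred (Vertex G) 0ℓ
  IsQuasiIsolated v = ∃[ S ] IsγₜSet S × IsQuasiIsolatedBy S v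

-- Each operation yields its result up to isomorphism.  In O₂ the new vertex
-- is the single vertex of P 1.
data _⟶_ (T T′ : Tree) : Set where
  O₁ : ∀ u v → InSomeγₜ-τSet (graph T) u → Graph.IsLeaf (P 4) v →
       (graph T +[ u , v ] P 4) ≅ graph T′ → T ⟶ T′
  O₂ : ∀ u → InSomeγₜ-τSet (graph T) u →
       (graph T +[ u , zero ] P 1) ≅ graph T′ → T ⟶ T′
  O₃ : ∀ u → InSomeγₜ-τSet (graph T) u → ¬ IsQuasiIsolated (graph T) u →
       (graph T +[ u , zero ] P 2) ≅ graph T′ → T ⟶ T′
  O₄ : ∀ u v → ¬ IsQuasiIsolated (graph T) u → Graph.IsSupport (P 4) v →
       (graph T +[ u , v ] P 4) ≅ graph T′ → T ⟶ T′

𝒯 : Pred Tree (Level.suc 0ℓ)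
𝒯 T = ∃[ T₁ ] P 4 ≅ graph T₁ × Star _⟶_ T₁ T

{-# OPTIONS --safe #-}
module Submission where

-- Each operation glues a small graph H to T along a bridge uv and raises both τ and γₜ by the same
-- constant: a total dominating set that leaves u to be dominated by v saves at most one vertex on
-- the old side, and this is either paid for in H or excluded because u is not quasi-isolated.
--
-- Conversely let S be a (γₜ-τ)-set of T.  S contains the supports but no leaf, and each of its
-- members has a neighbour outside S.  If two leaves share a neighbour, undo 𝒪₂.  Otherwise take the
-- end v₀, v₁, p, q of a longest path.  If p has a third neighbour, then undo 𝒪₃ (p keeps a
-- neighbour in S without v₁) or 𝒪₄ (it does not, and then p has exactly one leaf).  If p has degree
-- two, then q ∉ S; either T = P₄, or q has degree two and 𝒪₁ can be undone, or q has another
-- branch, to which the same analysis applies, and two branches of degree two contradict the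
-- minimality of S as a vertex cover.

open import Defs

open import Data.Bool.Base using (if_then_else_)
open import Data.Empty using (⊥-elim)
open import Data.Fin using (Fin; zero; suc; toℕ; fromℕ<; join; splitAt; _↑ˡ_; _≟_)
open import Data.Fin.Patterns
open import Data.Fin.Properties
  using (all?; any?; injective⇒≤; join-splitAt; pigeonhole; splitAt-join;
         toℕ-fromℕ; toℕ-injective; toℕ-inject₁; toℕ<n)
open import Data.Fin.Subset using (Subset; inside; outside; _∈_; _∉_; _∩_; _∪_; _-_; ⁅_⁆; ∣_∣)
open import Data.Fin.Subset.Properties
open import Data.List as List using (List; _∷_; allFin; filter)
open import Data.List.Membership.Propositional.Properties
  using (∈-allFin; ∈-filter⁺; ∈-filter⁻; ∈-lookup)
open import Data.List.Relation.Unary.All as All using ()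
open import Data.List.Relation.Unary.AllPairs using (_∷_)
open import Data.List.Relation.Unary.Any using (index)
open import Data.List.Relation.Unary.Any.Properties using (lookup-index)
open import Data.List.Relation.Unary.Unique.Propositional using (Unique)
open import Data.List.Relation.Unary.Unique.Propositional.Properties using (allFin⁺; filter⁺)
open import Data.Nat as ℕ using (ℕ; zero; suc; _+_; _≤_; _<_; _≤?_; z≤n; s≤s)
open import Data.Nat.Induction using (<-wellFounded)
open import Data.Nat.Properties hiding (_≟_)
open import Data.Product using (∃; ∃-syntax; _×_; _,_; proj₁; proj₂)
open import Data.Sum using (_⊎_; inj₁; inj₂; [_,_]′; swap) renaming (map to map⊎)
open import Data.Vec as Vec using ([]; _∷_; _++_; here; lookup; tabulate)
open import Data.Vec.Properties using ([]=⇒lookup; lookup⇒[]=; lookup-++ˡ; lookup-++ʳ; lookup∘tabulate)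
open import Data.Vec.Relation.Unary.All using ([]; _∷_)
open import Data.Vec.Relation.Unary.AllPairs using ([]; _∷_)
import Data.Vec.Relation.Unary.Unique.Propositional.Properties as VecUnique
open import Function using (_∘_; case_of_; id)
open import Function.Bundles using (_⇔_; Equivalence; Inverse; mk⇔; mk↔ₛ′)
open import Function.Definitions using (Injective)
open import Function.Properties.Inverse using (↔-sym)
open import Induction.WellFounded using (Acc; acc)
open import Level using (0ℓ)
open import Relation.Binary.Construct.Closure.ReflexiveTransitive using (Star; ε; _◅_; _◅◅_)
open import Relation.Binary.Definitions using (tri<; tri≈; tri>)
open import Relation.Binary.PropositionalEquality
open import Relation.Nullary using (¬_; ¬?; Dec; yes; no; contradiction; _×-dec_; _⊎-dec_; _→-dec_)
open import Relation.Nullary.Decidable using (dec-true; decidable-stable; map′; toWitness)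
open import Relation.Unary using (Decidable; Pred)

open import Algebra.Properties.CommutativeMonoid.Sum +-0-commutativeMonoid
  using (sum; sum-cong-≗; sum-permute)

-- Finite subsets: sizes, insertion, concatenation

∣p∪q∣≤∣p∣+∣q∣ : ∀ {n} (p q : Subset n) → ∣ p ∪ q ∣ ≤ ∣ p ∣ + ∣ q ∣
∣p∪q∣≤∣p∣+∣q∣ []            []            = z≤n
∣p∪q∣≤∣p∣+∣q∣ (outside ∷ p) (outside ∷ q) = ∣p∪q∣≤∣p∣+∣q∣ p q
∣p∪q∣≤∣p∣+∣q∣ (outside ∷ p) (inside  ∷ q) =
  subst (suc ∣ p ∪ q ∣ ≤_) (sym (+-suc ∣ p ∣ ∣ q ∣)) (s≤s (∣p∪q∣≤∣p∣+∣q∣ p q))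
∣p∪q∣≤∣p∣+∣q∣ (inside  ∷ p) (outside ∷ q) = s≤s (∣p∪q∣≤∣p∣+∣q∣ p q)
∣p∪q∣≤∣p∣+∣q∣ (inside  ∷ p) (inside  ∷ q) =
  s≤s (≤-trans (∣p∪q∣≤∣p∣+∣q∣ p q) (+-monoʳ-≤ ∣ p ∣ (n≤1+n ∣ q ∣)))

∣p++q∣≡∣p∣+∣q∣ : ∀ {m n} (p : Subset m) (q : Subset n) → ∣ p ++ q ∣ ≡ ∣ p ∣ + ∣ q ∣
∣p++q∣≡∣p∣+∣q∣ []            q = refl
∣p++q∣≡∣p∣+∣q∣ (outside ∷ p) q = ∣p++q∣≡∣p∣+∣q∣ p q
∣p++q∣≡∣p∣+∣q∣ (inside  ∷ p) q = cong suc (∣p++q∣≡∣p∣+∣q∣ p q)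

infixl 5 _⊕_

_⊕_ : ∀ {n} → Subset n → Fin n → Subset n
p ⊕ x = p ∪ ⁅ x ⁆

∈-⊕ˡ : ∀ {n} {p : Subset n} {x y} → y ∈ p → y ∈ p ⊕ x
∈-⊕ˡ y∈p = x∈p∪q⁺ (inj₁ y∈p)

∈-⊕ʳ : ∀ {n} (p : Subset n) x → x ∈ p ⊕ x
∈-⊕ʳ p x = x∈p∪q⁺ {p = p} (inj₂ (x∈⁅x⁆ x))

∈-⊕⁻ : ∀ {n} (p : Subset n) {x y} → y ∈ p ⊕ x → y ∈ p ⊎ y ≡ x
∈-⊕⁻ p {x} y∈ = map⊎ id (x∈⁅y⁆⇒x≡y x) (x∈p∪q⁻ p ⁅ x ⁆ y∈)

∣p⊕x∣≤1+∣p∣ : ∀ {n} (p : Subset n) x → ∣ p ⊕ x ∣ ≤ suc ∣ p ∣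
∣p⊕x∣≤1+∣p∣ p x = begin
  ∣ p ⊕ x ∣         ≤⟨ ∣p∪q∣≤∣p∣+∣q∣ p ⁅ x ⁆ ⟩
  ∣ p ∣ + ∣ ⁅ x ⁆ ∣ ≡⟨ cong (∣ p ∣ +_) (∣⁅x⁆∣≡1 x) ⟩
  ∣ p ∣ + 1         ≡⟨ +-comm ∣ p ∣ 1 ⟩
  suc ∣ p ∣         ∎
  where open ≤-Reasoning

∣p⊕y-x∣≤∣p∣ : ∀ {n} (p : Subset n) {x} y → x ∈ p → ∣ p ⊕ y - x ∣ ≤ ∣ p ∣
∣p⊕y-x∣≤∣p∣ p {x} y x∈p = ℕ.s≤s⁻¹ (≤-trans (x∈p⇒∣p-x∣<∣p∣ (∈-⊕ˡ {p = p} {y} x∈p)) (∣p⊕x∣≤1+∣p∣ p y))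

-- Makes statements about all vertex sets of `P 4` and `P 2` provable by evaluation.
all-subsets? : ∀ {n} {Q : Pred (Subset n) 0ℓ} → Decidable Q → Dec (∀ p → Q p)
all-subsets? Q? = map′ (λ ¬∃ p → decidable-stable (Q? p) λ ¬q → ¬∃ (p , ¬q))
                       (λ all (p , ¬q) → ¬q (all p))
                       (¬? (anySubset? (¬? ∘ Q?)))

join-elim : ∀ {m n} (Q : Fin (m + n) → Set) → (∀ s → Q (join m n s)) → ∀ z → Q z
join-elim {m} {n} Q q z = subst Q (join-splitAt m n z) (q (splitAt m z))

module _ {m n} {p : Subset m} {q : Subset n} where
  ∈-++⁺ : ∀ s → [ _∈ p , _∈ q ]′ s → join m n s ∈ p ++ q
  ∈-++⁺ (inj₁ x) x∈ = lookup⇒[]= _ _ (trans (lookup-++ˡ p q x) ([]=⇒lookup x∈))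
  ∈-++⁺ (inj₂ y) y∈ = lookup⇒[]= _ _ (trans (lookup-++ʳ p q y) ([]=⇒lookup y∈))

  ∈-++⁻ : ∀ s → join m n s ∈ p ++ q → [ _∈ p , _∈ q ]′ s
  ∈-++⁻ (inj₁ x) x∈ = lookup⇒[]= _ _ (trans (sym (lookup-++ˡ p q x)) ([]=⇒lookup x∈))
  ∈-++⁻ (inj₂ y) y∈ = lookup⇒[]= _ _ (trans (sym (lookup-++ʳ p q y)) ([]=⇒lookup y∈))

-- Working forms of total domination, minimality and quasi-isolation

module _ (G : Graph) where
  open Graph G using (order; Adj; adj?; symm)

  Dominated : Subset order → Vertex G → Set
  Dominated D x = ∃[ w ] w ∈ D × Adj x w

  Total : Pred (Subset order) 0ℓ
  Total D = ∀ x → Dominated D x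

  dominated? : ∀ D → Decidable (Dominated D)
  dominated? D x = any? λ w → (w ∈? D) ×-dec adj? x w

  vertexCover? : Decidable (IsVertexCover G)
  vertexCover? X = all? λ x → all? λ y → adj? x y →-dec ((x ∈? X) ⊎-dec (y ∈? X))

  -- A (γₜ-τ)-set, with minimality stated against every competitor. The numbers τ and γₜ do not
  -- appear, so transfer between graphs needs only inequalities of sizes.
  record Optimal (S : Subset order) : Set where
    field
      cover     : IsVertexCover G S
      total     : Total S
      cover-min : ∀ X → IsVertexCover G X → ∣ S ∣ ≤ ∣ X ∣
      total-min : ∀ D → Total D → ∣ S ∣ ≤ ∣ D ∣

  -- x ∈ pn(w, D)
  Private : Subset order → Vertex G → Vertex G → Set
  Private D w x = Adj x w × w ∈ D × (∀ z → Adj x z → z ∈ D → z ≡ w)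

  -- Here `D` is a γₜ-set, and the refuted combination of the last two conditions says pn(w, D) =
  -- {u}.
  NotQuasiIsolated : Pred (Vertex G) 0ℓ
  NotQuasiIsolated u = ∀ D w → Total D → (∀ D′ → Total D′ → ∣ D ∣ ≤ ∣ D′ ∣) → w ∈ D →
    Private D w u → ¬ (∀ x → Private D w x → x ≡ u)

  total⇒isTotalDominating : ∀ {D} → Total D → IsTotalDominating G D
  total⇒isTotalDominating td = inj₂ ∘ td , λ v _ → td v

  isTotalDominating⇒total : ∀ {D} → IsTotalDominating G D → Total D
  isTotalDominating⇒total (dom , noIsolated) v = [ noIsolated v , id ]′ (dom v)

  ∈N⁺ : ∀ {x y} → Adj x y → y ∈ Graph.N G x
  ∈N⁺ {x} {y} e =
    lookup⇒[]= y _ (trans (lookup∘tabulate _ y) (dec-true (adj? x y) e))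

  ∈N⁻ : ∀ {x y} → y ∈ Graph.N G x → Adj x y
  ∈N⁻ {x} {y} y∈ with adj? x y | trans (sym (lookup∘tabulate _ y)) ([]=⇒lookup y∈)
  ... | yes e | _  = e
  ... | no _  | ()

  private⇒pn : ∀ {D w x} → Private D w x → pn G w D x
  private⇒pn {D} {w} {x} (e , w∈D , only) = ⊆-antisym
    (λ z∈ → let z∈N , z∈D = x∈p∩q⁻ (Graph.N G x) D z∈ in
            subst (_∈ ⁅ w ⁆) (sym (only _ (∈N⁻ z∈N) z∈D)) (x∈⁅x⁆ w))
    (λ z∈ → subst (_∈ Graph.N G x ∩ D) (sym (x∈⁅y⁆⇒x≡y w z∈)) (x∈p∩q⁺ (∈N⁺ e , w∈D)))

  pn⇒private : ∀ {D w x} → pn G w D x → Private D w x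
  pn⇒private {D} {w} {x} eq =
    ∈N⁻ (proj₁ w∈) , proj₂ w∈ ,
    λ z e z∈D → x∈⁅y⁆⇒x≡y w (subst (z ∈_) eq (x∈p∩q⁺ (∈N⁺ e , z∈D)))
    where w∈ = x∈p∩q⁻ (Graph.N G x) D (subst (w ∈_) (sym eq) (x∈⁅x⁆ w))

  γₜ-set⁺ : ∀ {D} → Total D → (∀ D′ → Total D′ → ∣ D ∣ ≤ ∣ D′ ∣) → IsγₜSet G D
  γₜ-set⁺ {D} td min = td′ , (D , td′ , refl) , λ D′ → min D′ ∘ isTotalDominating⇒total
    where td′ = total⇒isTotalDominating td

  γₜ-set⁻ : ∀ {D} → IsγₜSet G D → Total D × (∀ D′ → Total D′ → ∣ D ∣ ≤ ∣ D′ ∣)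
  γₜ-set⁻ (td , _ , min) =
    isTotalDominating⇒total td , λ D′ → min D′ ∘ total⇒isTotalDominating

  optimal⇒γₜ-τ-set : ∀ {S} → Optimal S → Isγₜ-τSet G S
  optimal⇒γₜ-τ-set {S} o = γₜ-set⁺ total total-min , cover , (S , cover , refl) , cover-min
    where open Optimal o

  γₜ-τ-set⇒optimal : ∀ {S} → Isγₜ-τSet G S → Optimal S
  γₜ-τ-set⇒optimal (γ , cover , _ , cover-min) = record
    { cover = cover ; total = proj₁ (γₜ-set⁻ γ)
    ; cover-min = cover-min ; total-min = proj₂ (γₜ-set⁻ γ) }

  ¬quasiIsolated⁺ : ∀ {u} → NotQuasiIsolated u → ¬ IsQuasiIsolated G u
  ¬quasiIsolated⁺ nq (D , γ , w , w∈D , pn⊆ , ⊆pn) =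
    nq D w (proj₁ (γₜ-set⁻ γ)) (proj₂ (γₜ-set⁻ γ)) w∈D (pn⇒private (⊆pn refl))
      λ x → sym ∘ pn⊆ ∘ private⇒pn

  ¬quasiIsolated⁻ : ∀ {u} → ¬ IsQuasiIsolated G u → NotQuasiIsolated u
  ¬quasiIsolated⁻ ¬q D w td min w∈D pu only = ¬q
    (D , γₜ-set⁺ td min , w , w∈D ,
     (λ {x} → sym ∘ only x ∘ pn⇒private) , λ { refl → private⇒pn pu })

-- Vertex covers and total dominating sets of a sum

module _ {G H : Graph} {u : Vertex G} {v : Vertex H} where
  private
    m = Graph.order G
    n = Graph.order H
    G+H = G +[ u , v ] H

  sumAdj⁺ : ∀ s t → SumAdj G H u v s t → Graph.Adj G+H (join m n s) (join m n t)
  sumAdj⁺ s t = subst₂ (SumAdj G H u v) (sym (splitAt-join m n s)) (sym (splitAt-join m n t))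

  sumAdj⁻ : ∀ s t → Graph.Adj G+H (join m n s) (join m n t) → SumAdj G H u v s t
  sumAdj⁻ s t = subst₂ (SumAdj G H u v) (splitAt-join m n s) (splitAt-join m n t)

  module _ {X : Subset m} {Y : Subset n} where
    cover-++⁺ : IsVertexCover G X → IsVertexCover H Y → u ∈ X ⊎ v ∈ Y →
                IsVertexCover G+H (X ++ Y)
    cover-++⁺ cX cY uv = join-elim _ λ s → join-elim _ λ t e →
      map⊎ (∈-++⁺ s) (∈-++⁺ t) (go (sumAdj⁻ s t e))
      where
      go : ∀ {s t} → SumAdj G H u v s t → [ _∈ X , _∈ Y ]′ s ⊎ [ _∈ X , _∈ Y ]′ t
      go (left e)  = cX _ _ e
      go (right e) = cY _ _ e
      go bridge    = uv
      go bridge′   = swap uv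

    cover-++⁻ : IsVertexCover G+H (X ++ Y) →
                IsVertexCover G X × IsVertexCover H Y × (u ∈ X ⊎ v ∈ Y)
    cover-++⁻ c =
      (λ x y e → go (inj₁ x) (inj₁ y) (left e)) ,
      (λ x y e → go (inj₂ x) (inj₂ y) (right e)) ,
      go (inj₁ u) (inj₂ v) bridge
      where
      go : ∀ s t → SumAdj G H u v s t → [ _∈ X , _∈ Y ]′ s ⊎ [ _∈ X , _∈ Y ]′ t
      go s t e = map⊎ (∈-++⁻ s) (∈-++⁻ t) (c _ _ (sumAdj⁺ s t e))

    -- The bridge can supply a dominator to its two ends only, whence the exceptional alternatives
    -- for `u` and `v`.
    total-++⁺ : (∀ x → Dominated G X x ⊎ x ≡ u × v ∈ Y) →
                (∀ y → Dominated H Y y ⊎ y ≡ v × u ∈ X) → Total G+H (X ++ Y)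
    total-++⁺ dX dY = join-elim _ λ s → let t , t∈ , e = go s in
      join m n t , ∈-++⁺ t t∈ , sumAdj⁺ s t e
      where
      go : ∀ s → ∃[ t ] [ _∈ X , _∈ Y ]′ t × SumAdj G H u v s t
      go (inj₁ x) with dX x
      ... | inj₁ (w , w∈ , e) = inj₁ w , w∈ , left e
      ... | inj₂ (refl , v∈)  = inj₂ v , v∈ , bridge
      go (inj₂ y) with dY y
      ... | inj₁ (w , w∈ , e) = inj₂ w , w∈ , right e
      ... | inj₂ (refl , u∈)  = inj₁ u , u∈ , bridge′

    total-++⁻ : Total G+H (X ++ Y) →
                (∀ x → Dominated G X x ⊎ x ≡ u × v ∈ Y) ×
                (∀ y → Dominated H Y y ⊎ y ≡ v × u ∈ X)
    total-++⁻ td = (λ x → fromG (go (inj₁ x))) , (λ y → fromH (go (inj₂ y)))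
      where
      go : ∀ s → ∃[ t ] [ _∈ X , _∈ Y ]′ t × SumAdj G H u v s t
      go s with td (join m n s)
      ... | z , z∈ , e = splitAt m z , ∈-++⁻ (splitAt m z) (subst (_∈ X ++ Y) (sym (join-splitAt m n z)) z∈) ,
                         subst (λ s → SumAdj G H u v s (splitAt m z)) (splitAt-join m n s) e

      fromG : ∀ {x} → ∃[ t ] [ _∈ X , _∈ Y ]′ t × SumAdj G H u v (inj₁ x) t →
              Dominated G X x ⊎ x ≡ u × v ∈ Y
      fromG (_ , t∈ , left e) = inj₁ (_ , t∈ , e)
      fromG (_ , t∈ , bridge) = inj₂ (refl , t∈)

      fromH : ∀ {y} → ∃[ t ] [ _∈ X , _∈ Y ]′ t × SumAdj G H u v (inj₂ y) t →
              Dominated H Y y ⊎ y ≡ v × u ∈ X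
      fromH (_ , t∈ , right e) = inj₁ (_ , t∈ , e)
      fromH (_ , t∈ , bridge′) = inj₂ (refl , t∈)

-- Local changes to dominating sets and covers in one graph

module _ {G : Graph} where
  open Graph G using (order; Adj; symm)

  total-⊕ : ∀ {D u w} → (∀ x → x ≢ u → Dominated G D x) → Adj u w → Total G (D ⊕ w)
  total-⊕ {D} {u} {w} dom e x with x ≟ u
  ... | yes refl = w , ∈-⊕ʳ D w , e
  ... | no x≢u   = let z , z∈ , e′ = dom x x≢u in z , ∈-⊕ˡ z∈ , e′

  -- One added neighbour of `u` repairs `D`, so leaving `u` undominated saves at most one vertex.
  total-min-deficient : ∀ {S D u w} → Optimal G S → (∀ x → x ≢ u → Dominated G D x) →
                        Adj u w → ∣ S ∣ ≤ suc ∣ D ∣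
  total-min-deficient {D = D} {w = w} o dom e =
    ≤-trans (Optimal.total-min o _ (total-⊕ dom e)) (∣p⊕x∣≤1+∣p∣ D w)

  -- If `D` misses `u` and is smaller than `S`, adding a neighbour `w` of `u` yields a γₜ-set. All
  -- vertices other than `u` already had a neighbour in `D`, and `w` is not in `D`, so pn(w, D ⊕ w)
  -- = {u} and `u` would be quasi-isolated.
  total-min-notQuasiIsolated : ∀ {S D u} → Optimal G S → NotQuasiIsolated G u →
                               (∀ x → x ≢ u → Dominated G D x) → ∣ S ∣ ≤ ∣ D ∣
  total-min-notQuasiIsolated {S} {D} {u} o nq dom with dominated? G D u
  ... | yes du = Optimal.total-min o D λ x → case x ≟ u of λ where
          (yes refl) → du
          (no x≢u)   → dom x x≢u
  ... | no ¬du = decidable-stable (∣ S ∣ ≤? ∣ D ∣) λ S≰D →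
    let w , _ , e = Optimal.total o u
        D⊕w≤S : ∣ D ⊕ w ∣ ≤ ∣ S ∣
        D⊕w≤S = ≤-trans (∣p⊕x∣≤1+∣p∣ D w) (≰⇒> S≰D)
        nbr-w : ∀ z → Adj u z → z ∈ D ⊕ w → z ≡ w
        nbr-w z e′ z∈ = [ (λ z∈D → contradiction (z , z∈D , e′) ¬du) , id ]′ (∈-⊕⁻ D z∈)
        w∉D : w ∉ D
        w∉D w∈D = ¬du (w , w∈D , e)
        only-u : ∀ x → Private G (D ⊕ w) w x → x ≡ u
        only-u x (_ , _ , only) = decidable-stable (x ≟ u) λ x≢u →
          let z , z∈D , e′ = dom x x≢u in
          w∉D (subst (_∈ D) (only z e′ (∈-⊕ˡ z∈D)) z∈D)
    in nq (D ⊕ w) w (total-⊕ dom e) (λ D′ td → ≤-trans D⊕w≤S (Optimal.total-min o D′ td))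
          (∈-⊕ʳ D w) (e , ∈-⊕ʳ D w , nbr-w) only-u

  -- A vertex that loses its last dominator with `w` had `w` as its only neighbour in `D`.
  dominated-delete : ∀ {D w x} → Total G D → ¬ Private G D w x → Dominated G (D - w) x
  dominated-delete {D} {w} {x} td ¬p = decidable-stable (dominated? G (D - w) x) λ ¬d →
    let only : ∀ z → Adj x z → z ∈ D → z ≡ w
        only z e z∈ = decidable-stable (z ≟ w) λ z≢w → ¬d (z , x∈p∧x≢y⇒x∈p-y z∈ z≢w , e)
        z , z∈ , e = td x
        z≡w = only z e z∈
    in ¬p (subst (Adj x) z≡w e , subst (_∈ D) z≡w z∈ , only)

  cover-⊕ : ∀ {X} y → IsVertexCover G X → IsVertexCover G (X ⊕ y)
  cover-⊕ y c a b e = map⊎ ∈-⊕ˡ ∈-⊕ˡ (c a b e)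

  -- The edges at `x` stay covered by their other ends, which differ from `x`.
  cover-delete : ∀ {X x} → IsVertexCover G X → (∀ z → Adj x z → z ∈ X) →
                 IsVertexCover G (X - x)
  cover-delete {X} {x} c nbrs a b e with a ≟ x | b ≟ x
  ... | yes refl | _        = inj₂ (x∈p∧x≢y⇒x∈p-y (nbrs b e) λ { refl → Graph.irrefl G refl e })
  ... | no a≢x   | yes refl = inj₁ (x∈p∧x≢y⇒x∈p-y (nbrs a (symm e)) a≢x)
  ... | no a≢x   | no b≢x   =
    map⊎ (λ a∈ → x∈p∧x≢y⇒x∈p-y a∈ a≢x) (λ b∈ → x∈p∧x≢y⇒x∈p-y b∈ b≢x) (c a b e)

-- Optimal sets of a sum, built up and cut down

module _ {G H : Graph} {u : Vertex G} {v : Vertex H} where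
  private
    m = Graph.order G
    n = Graph.order H
    G+H = G +[ u , v ] H

  -- Here `c` is the common amount by which τ and γₜ grow. `X` already dominates all of `G`, so only
  -- the vertices of `H` and the bridge carry conditions.
  record Extension (c : ℕ) (X : Subset m) (Y : Subset n) : Set where
    field
      size      : ∣ Y ∣ ≤ c
      cover     : IsVertexCover H Y
      bridged   : u ∈ X ⊎ v ∈ Y
      dominated : ∀ y → Dominated H Y y ⊎ y ≡ v × u ∈ X

  -- The extension bounds both invariants from above. A cover of the sum splits into covers of both
  -- sides, so its lower bound is needed on `H` alone; a total dominating set may leave `u` to `v`,
  -- so its lower bound concerns both parts at once.
  optimal-++⁺ : ∀ {c X Y} → Optimal G X → Extension c X Y →
    (∀ Z → IsVertexCover H Z → c ≤ ∣ Z ∣) →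
    (∀ D Z → Total G+H (D ++ Z) → ∣ X ∣ + c ≤ ∣ D ∣ + ∣ Z ∣) → Optimal G+H (X ++ Y)
  optimal-++⁺ {c} {X} {Y} o ext cover-low total-low = record
    { cover     = cover-++⁺ (Optimal.cover o) cover bridged
    ; total     = total-++⁺ (λ x → inj₁ (Optimal.total o x)) dominated
    ; cover-min = λ W cW → bound W λ A B eq →
        let cA , cB , _ = cover-++⁻ (subst (IsVertexCover G+H) eq cW)
        in +-mono-≤ (Optimal.cover-min o A cA) (cover-low B cB)
    ; total-min = λ W tW → bound W λ A B eq → total-low A B (subst (Total G+H) eq tW)
    }
    where
    open Extension ext
    bound : ∀ W → (∀ A B → W ≡ A ++ B → ∣ X ∣ + c ≤ ∣ A ∣ + ∣ B ∣) → ∣ X ++ Y ∣ ≤ ∣ W ∣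
    bound W f with Vec.splitAt m W
    ... | A , B , eq = begin
      ∣ X ++ Y ∣    ≡⟨ ∣p++q∣≡∣p∣+∣q∣ X Y ⟩
      ∣ X ∣ + ∣ Y ∣ ≤⟨ +-monoʳ-≤ ∣ X ∣ size ⟩
      ∣ X ∣ + c     ≤⟨ f A B eq ⟩
      ∣ A ∣ + ∣ B ∣ ≡⟨ sym (∣p++q∣≡∣p∣+∣q∣ A B) ⟩
      ∣ A ++ B ∣    ≡⟨ cong ∣_∣ (sym eq) ⟩
      ∣ W ∣         ∎
      where open ≤-Reasoning

  -- The two ways in which the operations guarantee γₜ(G) + c ≤ γₜ(G + H).
  total-low-heavy : ∀ {c X} → Optimal G X →
    (∀ Z → (∀ y → y ≢ v → Dominated H Z y) → c ≤ ∣ Z ∣ × (v ∈ Z → c < ∣ Z ∣)) →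
    ∀ D Z → Total G+H (D ++ Z) → ∣ X ∣ + c ≤ ∣ D ∣ + ∣ Z ∣
  total-low-heavy {c} {X} o low D Z td with total-++⁻ td
  ... | dD , dZ with low Z (λ y y≢v → [ id , (λ (y≡v , _) → contradiction y≡v y≢v) ]′ (dZ y))
  ... | c≤Z , heavy with dD u
  ... | inj₁ du = +-mono-≤ (Optimal.total-min o D tD) c≤Z
    where
    tD : Total G D
    tD x = [ id , (λ { (refl , _) → du }) ]′ (dD x)
  -- Now `u` relies on `v`: `D` may be one vertex short, but `Z` then contains `v` and has one
  -- vertex to spare.
  ... | inj₂ (_ , v∈Z) = begin
      ∣ X ∣ + c       ≤⟨ +-monoˡ-≤ c (total-min-deficient o dom (proj₂ (proj₂ (Optimal.total o u)))) ⟩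
      suc ∣ D ∣ + c   ≡⟨ sym (+-suc ∣ D ∣ c) ⟩
      ∣ D ∣ + suc c   ≤⟨ +-monoʳ-≤ ∣ D ∣ (heavy v∈Z) ⟩
      ∣ D ∣ + ∣ Z ∣   ∎
    where
    open ≤-Reasoning
    dom : ∀ x → x ≢ u → Dominated G D x
    dom x x≢u = [ id , (λ (x≡u , _) → contradiction x≡u x≢u) ]′ (dD x)

  total-low-notQuasiIsolated : ∀ {c X} → Optimal G X → NotQuasiIsolated G u →
    (∀ Z → (∀ y → y ≢ v → Dominated H Z y) → c ≤ ∣ Z ∣) →
    ∀ D Z → Total G+H (D ++ Z) → ∣ X ∣ + c ≤ ∣ D ∣ + ∣ Z ∣
  total-low-notQuasiIsolated o nq low D Z td with total-++⁻ td
  ... | dD , dZ = +-mono-≤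
    (total-min-notQuasiIsolated o nq λ x x≢u →
      [ id , (λ (x≡u , _) → contradiction x≡u x≢u) ]′ (dD x))
    (low Z λ y y≢v → [ id , (λ (y≡v , _) → contradiction y≡v y≢v) ]′ (dZ y))

  -- Only `v` has a neighbour outside `H`, so `Z` itself dominates all other vertices of `H`.
  total-++-size : ∀ {c X Z} → Total G+H (X ++ Z) →
    (∀ W → (∀ y → y ≢ v → Dominated H W y) → c ≤ ∣ W ∣) → c ≤ ∣ Z ∣
  total-++-size {Z = Z} td low = low Z λ y y≢v →
    [ id , (λ (y≡v , _) → contradiction y≡v y≢v) ]′ (proj₂ (total-++⁻ td) y)

  -- Every competitor `A` on `G` extends to the sum at cost at most `c`, while `Z` already costs at
  -- least `c`; hence `A` cannot be smaller than `X`.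
  optimal-++⁻ : ∀ {c X Z} → Optimal G+H (X ++ Z) → c ≤ ∣ Z ∣ → Dominated G X u →
    (∀ A → IsVertexCover G A → ∃[ W ] IsVertexCover G+H W × ∣ W ∣ ≤ ∣ A ∣ + c) →
    (∀ A → Total G A → ∃[ W ] Total G+H W × ∣ W ∣ ≤ ∣ A ∣ + c) → Optimal G X
  optimal-++⁻ {c} {X} {Z} o c≤Z du cover-up total-up = record
    { cover     = proj₁ (cover-++⁻ (Optimal.cover o))
    ; total     = λ x → [ id , (λ { (refl , _) → du }) ]′ (proj₁ (total-++⁻ (Optimal.total o)) x)
    ; cover-min = λ A cA → let W , cW , W≤ = cover-up A cA in
                  bound A (≤-trans (Optimal.cover-min o W cW) W≤)
    ; total-min = λ A tA → let W , tW , W≤ = total-up A tA in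
                  bound A (≤-trans (Optimal.total-min o W tW) W≤)
    }
    where
    bound : ∀ (A : Subset m) → ∣ X ++ Z ∣ ≤ ∣ A ∣ + c → ∣ X ∣ ≤ ∣ A ∣
    bound A le = +-cancelʳ-≤ c ∣ X ∣ ∣ A ∣ (begin
      ∣ X ∣ + c     ≤⟨ +-monoʳ-≤ ∣ X ∣ c≤Z ⟩
      ∣ X ∣ + ∣ Z ∣ ≡⟨ sym (∣p++q∣≡∣p∣+∣q∣ X Z) ⟩
      ∣ X ++ Z ∣    ≤⟨ le ⟩
      ∣ A ∣ + c     ∎)
      where open ≤-Reasoning

  notQuasiIsolated-++⁻ : ∀ {c X Z Y} → Optimal G+H (X ++ Z) → c ≤ ∣ Z ∣ → Optimal G X →
    ∣ Y ∣ ≤ c → v ∈ Y →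
    (∀ D w → Total G D → Private G D w u → (∀ x → Private G D w x → x ≡ u) →
      ∀ y → Dominated H Y y ⊎ y ≡ v × u ∈ D) →
    NotQuasiIsolated G u
  notQuasiIsolated-++⁻ {c} {X} {Z} {Y} o c≤Z oX Y≤c v∈Y dY D w tD minD w∈D pu only =
    <-irrefl refl (begin-strict
      ∣ X ∣ + ∣ Z ∣     ≡⟨ sym (∣p++q∣≡∣p∣+∣q∣ X Z) ⟩
      ∣ X ++ Z ∣        ≤⟨ Optimal.total-min o _ td ⟩
      ∣ (D - w) ++ Y ∣  ≡⟨ ∣p++q∣≡∣p∣+∣q∣ (D - w) Y ⟩
      ∣ D - w ∣ + ∣ Y ∣ <⟨ +-mono-<-≤ (x∈p⇒∣p-x∣<∣p∣ w∈D) (≤-trans Y≤c c≤Z) ⟩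
      ∣ D ∣ + ∣ Z ∣     ≤⟨ +-monoˡ-≤ ∣ Z ∣ (minD X (Optimal.total oX)) ⟩
      ∣ X ∣ + ∣ Z ∣     ∎)
    where
    open ≤-Reasoning
    u≢w : u ≢ w
    u≢w refl = Graph.irrefl G refl (proj₁ pu)
    td : Total G+H ((D - w) ++ Y)
    td = total-++⁺
      (λ x → case x ≟ u of λ where
        (yes x≡u) → inj₂ (x≡u , v∈Y)
        (no x≢u)  → inj₁ (dominated-delete {G = G} tD λ p → x≢u (only x p)))
      (λ y → map⊎ id (λ (y≡v , u∈D) → y≡v , x∈p∧x≢y⇒x∈p-y u∈D u≢w) (dY D w tD pu only y))

-- Invariance under isomorphism

∣p∣≡sum : ∀ {n} (p : Subset n) → ∣ p ∣ ≡ sum λ x → if lookup p x then 1 else 0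
∣p∣≡sum []            = refl
∣p∣≡sum (outside ∷ p) = ∣p∣≡sum p
∣p∣≡sum (inside  ∷ p) = cong suc (∣p∣≡sum p)

≅-sym : ∀ {G H} → G ≅ H → H ≅ G
≅-sym {G} {H} φ = record
  { bijection = ↔-sym bijection
  ; adj⇔      = λ x y → mk⇔
      (λ e → Equivalence.from (adj⇔ (from x) (from y)) (subst₂ (Graph.Adj H) (sym (inverseˡ refl)) (sym (inverseˡ refl)) e))
      (λ e → subst₂ (Graph.Adj H) (inverseˡ refl) (inverseˡ refl) (Equivalence.to (adj⇔ (from x) (from y)) e))
  }
  where
  open _≅_ φ
  open Inverse bijection

module _ {G H : Graph} (φ : G ≅ H) where
  open _≅_ φ
  open Inverse bijection

  preimage : Subset (Graph.order H) → Subset (Graph.order G)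
  preimage X = tabulate (lookup X ∘ to)

  ∈-preimage⁺ : ∀ {X x} → to x ∈ X → x ∈ preimage X
  ∈-preimage⁺ {x = x} x∈ = lookup⇒[]= x _ (trans (lookup∘tabulate _ x) ([]=⇒lookup x∈))

  -- The size is a sum of indicator values, which the bijection merely permutes.
  ∣preimage∣ : ∀ X → ∣ preimage X ∣ ≡ ∣ X ∣
  ∣preimage∣ X = begin
    ∣ preimage X ∣                                   ≡⟨ ∣p∣≡sum (preimage X) ⟩
    sum (λ x → if lookup (preimage X) x then 1 else 0)
      ≡⟨ sum-cong-≗ (λ x → cong (if_then 1 else 0) (lookup∘tabulate (lookup X ∘ to) x)) ⟩
    sum (λ x → if lookup X (to x) then 1 else 0)     ≡⟨ sum-permute _ bijection ⟨
    sum (λ x → if lookup X x then 1 else 0)          ≡⟨ ∣p∣≡sum X ⟨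
    ∣ X ∣                                            ∎
    where open ≡-Reasoning

  cover-preimage : ∀ {X} → IsVertexCover H X → IsVertexCover G (preimage X)
  cover-preimage c x y e =
    map⊎ ∈-preimage⁺ ∈-preimage⁺ (c (to x) (to y) (Equivalence.to (adj⇔ x y) e))

  total-preimage : ∀ {X} → Total H X → Total G (preimage X)
  total-preimage {X} td x with td (to x)
  ... | w , w∈ , e = from w , ∈-preimage⁺ (subst (_∈ X) (sym (inverseˡ refl)) w∈) ,
        Equivalence.from (adj⇔ x (from w)) (subst (Graph.Adj H (to x)) (sym (inverseˡ refl)) e)

-- A competitor in `G` is compared through its preimage under the inverse isomorphism.
optimal-preimage : ∀ {G H} (φ : G ≅ H) {S} → Optimal H S → Optimal G (preimage φ S)
optimal-preimage φ {S} o = record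
  { cover     = cover-preimage φ cover
  ; total     = total-preimage φ total
  ; cover-min = λ X c → subst₂ _≤_ (sym (∣preimage∣ φ S)) (∣preimage∣ (≅-sym φ) X)
                          (cover-min _ (cover-preimage (≅-sym φ) c))
  ; total-min = λ X t → subst₂ _≤_ (sym (∣preimage∣ φ S)) (∣preimage∣ (≅-sym φ) X)
                          (total-min _ (total-preimage (≅-sym φ) t))
  }
  where open Optimal o

-- Bounds for the attached paths, checked exhaustively

dominatedExcept? : ∀ G v → Decidable λ Z → ∀ y → y ≢ v → Dominated G Z y
dominatedExcept? G v Z = all? λ y → ¬? (y ≟ v) →-dec dominated? G Z y

P₄-cover-low : ∀ Z → IsVertexCover (P 4) Z → 2 ≤ ∣ Z ∣
P₄-cover-low = toWitness {a? = all-subsets? λ Z → vertexCover? (P 4) Z →-dec 2 ≤? ∣ Z ∣} _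

-- The vertex `v` is exempt because in a sum it may be dominated across the bridge.
P₄-total-low : ∀ v Z → (∀ y → y ≢ v → Dominated (P 4) Z y) → 2 ≤ ∣ Z ∣
P₄-total-low = toWitness {a? = all? λ v → all-subsets? λ Z →
  dominatedExcept? (P 4) v Z →-dec 2 ≤? ∣ Z ∣} _

-- The opposite leaf puts its neighbour in `Z`, that neighbour needs a dominator in `Z` itself, and
-- `v` is a third vertex.
P₄-total-low-leaf : ∀ v → Graph.IsLeaf (P 4) v → ∀ Z → (∀ y → y ≢ v → Dominated (P 4) Z y) →
                    v ∈ Z → 2 < ∣ Z ∣
P₄-total-low-leaf = toWitness {a? = all? λ v → (Graph.degree (P 4) v ℕ.≟ 1) →-dec
  all-subsets? λ Z → dominatedExcept? (P 4) v Z →-dec (v ∈? Z →-dec 3 ≤? ∣ Z ∣)} _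

P₂-cover-low : ∀ Z → IsVertexCover (P 2) Z → 1 ≤ ∣ Z ∣
P₂-cover-low = toWitness {a? = all-subsets? λ Z → vertexCover? (P 2) Z →-dec 1 ≤? ∣ Z ∣} _

P₂-total-low : ∀ Z → (∀ y → y ≢ 0F → Dominated (P 2) Z y) → 1 ≤ ∣ Z ∣
P₂-total-low = toWitness {a? = all-subsets? λ Z →
  dominatedExcept? (P 2) 0F Z →-dec 1 ≤? ∣ Z ∣} _

-- The two support vertices, which every total dominating set of `P 4` contains.
middle : Subset 4
middle = outside ∷ inside ∷ inside ∷ outside ∷ []

middle-cover : IsVertexCover (P 4) middle
middle-cover = toWitness {a? = vertexCover? (P 4) middle} _

middle-total : Total (P 4) middle
middle-total = toWitness {a? = all? (dominated? (P 4) middle)} _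

support∈middle : ∀ v → Graph.IsSupport (P 4) v → v ∈ middle
support∈middle = toWitness {a? = all? λ v →
  any? (λ u → Graph.adj? (P 4) v u ×-dec (Graph.degree (P 4) u ℕ.≟ 1)) →-dec (v ∈? middle)} _

P₄-optimal : Optimal (P 4) middle
P₄-optimal = record
  { cover     = middle-cover
  ; total     = middle-total
  ; cover-min = P₄-cover-low
  ; total-min = λ Z td → P₄-total-low 0F Z λ y _ → td y
  }

P₂-cover : IsVertexCover (P 2) ⁅ 0F ⁆
P₂-cover = toWitness {a? = vertexCover? (P 2) ⁅ 0F ⁆} _

P₂-dominated : ∀ y → Dominated (P 2) ⁅ 0F ⁆ y ⊎ y ≡ 0F
P₂-dominated = toWitness {a? = all? λ y → dominated? (P 2) ⁅ 0F ⁆ y ⊎-dec (y ≟ 0F)} _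

-- From the family to (γₜ-τ)-sets: each operation preserves them

⟶-optimal : ∀ {T T′} → T ⟶ T′ → ∃ (Optimal (graph T)) → ∃ (Optimal (graph T′))
-- In the four cases τ and γₜ both grow by 2, 0, 1 and 2 respectively.
⟶-optimal {T} (O₁ u v (X , γτ , u∈X) leaf φ) _ =
  _ , optimal-preimage (≅-sym φ) (optimal-++⁺ o ext P₄-cover-low
        (total-low-heavy o λ Z d → P₄-total-low v Z d , P₄-total-low-leaf v leaf Z d))
  where
  o = γₜ-τ-set⇒optimal (graph T) γτ
  ext : Extension {G = graph T} {H = P 4} {u} {v} 2 X middle
  ext = record { size = ≤-refl ; cover = middle-cover ; bridged = inj₁ u∈X
               ; dominated = inj₁ ∘ middle-total }
-- The new vertex is dominated by `u`, which also covers its edge, so `c` is 0; if the new vertex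
-- serves to dominate `u`, it pays for itself.
⟶-optimal {T} (O₂ u (X , γτ , u∈X) φ) _ =
  _ , optimal-preimage (≅-sym φ) (optimal-++⁺ o ext (λ _ _ → z≤n)
        (total-low-heavy o λ { Z _ → z≤n , λ 0∈Z → x∈p⇒∣p∣>0 0∈Z }))
  where
  o = γₜ-τ-set⇒optimal (graph T) γτ
  x∈p⇒∣p∣>0 : ∀ {n} {p : Subset n} {x} → x ∈ p → 0 < ∣ p ∣
  x∈p⇒∣p∣>0 x∈p = ≤-trans (s≤s z≤n) (x∈p⇒∣p-x∣<∣p∣ x∈p)
  ext : Extension {G = graph T} {H = P 1} {u} {0F} 0 X (outside ∷ [])
  ext = record { size = z≤n ; cover = λ { 0F 0F (inj₁ ()) ; 0F 0F (inj₂ ()) } ; bridged = inj₁ u∈X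
               ; dominated = λ { 0F → inj₂ (refl , u∈X) } }
⟶-optimal {T} (O₃ u (X , γτ , u∈X) ¬q φ) _ =
  _ , optimal-preimage (≅-sym φ) (optimal-++⁺ o ext P₂-cover-low
        (total-low-notQuasiIsolated o (¬quasiIsolated⁻ (graph T) ¬q) P₂-total-low))
  where
  o = γₜ-τ-set⇒optimal (graph T) γτ
  ext : Extension {G = graph T} {H = P 2} {u} {0F} 1 X ⁅ 0F ⁆
  ext = record { size = ≤-refl ; cover = P₂-cover ; bridged = inj₁ u∈X
               ; dominated = λ y → map⊎ id (_, u∈X) (P₂-dominated y) }
-- The bridge is covered by `v`, which lies in `middle`, so the optimal set at hand is extended
-- wherever `u` lies.
⟶-optimal {T} (O₄ u v ¬q support φ) (X , o) =
  _ , optimal-preimage (≅-sym φ) (optimal-++⁺ o ext P₄-cover-low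
        (total-low-notQuasiIsolated o (¬quasiIsolated⁻ (graph T) ¬q) (P₄-total-low v)))
  where
  ext : Extension {G = graph T} {H = P 4} {u} {v} 2 X middle
  ext = record { size = ≤-refl ; cover = middle-cover ; bridged = inj₂ (support∈middle v support)
               ; dominated = inj₁ ∘ middle-total }

𝒯⇒optimal : ∀ {T} → 𝒯 T → ∃ (Optimal (graph T))
𝒯⇒optimal (T₁ , φ , steps) = go steps (_ , optimal-preimage (≅-sym φ) P₄-optimal)
  where
  go : ∀ {T T′} → Star _⟶_ T T′ → ∃ (Optimal (graph T)) → ∃ (Optimal (graph T′))
  go ε            o = o
  go (step ◅ steps) o = go steps (⟶-optimal step o)

-- Longest trails in an acyclic graph

module _ (G : Graph) where
  open Graph G using (order; Adj; adj?; symm)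

  Leaf : Vertex G → Vertex G → Set
  Leaf x y = Adj x y × (∀ z → Adj x z → z ≡ y)

  -- Walks x, y, … with 1 + l edges and no immediate backtracking.
  data Trail : ℕ → Vertex G → Vertex G → Set where
    edge : ∀ {x y} → Adj x y → Trail zero x y
    cons : ∀ {l x y z} → Adj x y → z ≢ x → Trail l y z → Trail (suc l) x y

  trail? : ∀ l x y → Dec (Trail l x y)
  trail? zero    x y = map′ edge (λ { (edge e) → e }) (adj? x y)
  trail? (suc l) x y = map′ (λ (e , _ , z≢x , t) → cons e z≢x t)
                            (λ { (cons e z≢x t) → e , _ , z≢x , t })
                            (adj? x y ×-dec any? λ z → ¬? (z ≟ x) ×-dec trail? l y z)

  -- The vertices have indices 0 to `suc l`; larger indices repeat the last vertex.
  at : ∀ {l x y} → Trail l x y → ℕ → Vertex G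
  at {x = x} _           zero    = x
  at {y = y} (edge _)    (suc _) = y
  at         (cons _ _ t) (suc i) = at t i

  at-1 : ∀ {l x y} (t : Trail l x y) → at t 1 ≡ y
  at-1 (edge _)     = refl
  at-1 (cons _ _ _) = refl

  trail-head : ∀ {l x y} → Trail l x y → Adj x y
  trail-head (edge e)     = e
  trail-head (cons e _ _) = e

  trail-step : ∀ {l x y} (t : Trail l x y) {i} → i ≤ l → Adj (at t i) (at t (suc i))
  trail-step t            z≤n       = subst (Adj _) (sym (at-1 t)) (trail-head t)
  trail-step (cons _ _ t) (s≤s i≤l) = trail-step t i≤l

  trail-turn : ∀ {l x y} (t : Trail l x y) {i} → i < l → at t i ≢ at t (suc (suc i))
  trail-turn (cons _ z≢x t) {zero}  _         eq = z≢x (sym (trans eq (at-1 t)))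
  trail-turn (cons _ _ t)   {suc i} (s≤s i<l)    = trail-turn t i<l

  -- The vertices between two nearest equal vertices of a trail would form a cycle.
  trail-no-return : ¬ Graph.Cycle G → ∀ {l x y} (t : Trail l x y) d →
    (∀ {i j} → i < j → j ≤ i + d → j ≤ suc l → at t i ≢ at t j) →
    ∀ {i} → i + d ≤ l → at t i ≢ at t (suc (i + d))
  -- The gap between the two positions is `suc d`. Gap 1 would be a loop and gap 2 a backtrack; from
  -- gap 3 on the segment closes to a cycle.
  trail-no-return _ {l} t zero _ {i} i≤l eq =
    Graph.irrefl G (trans eq (cong (at t ∘ suc) (+-identityʳ i)))
      (trail-step t (subst (_≤ l) (+-identityʳ i) i≤l))
  trail-no-return _ {l} t (suc zero) _ {i} i<l eq =
    trail-turn t (subst (_≤ l) (+-comm i 1) i<l) (trans eq (cong (at t ∘ suc) (+-comm i 1)))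
  trail-no-return acyclic {l} t d@(suc (suc k)) near {i} i+d≤l eq = acyclic record
    { k         = k
    ; vertex    = vertex
    ; injective = injective
    ; step      = λ a → subst₂ Adj (cong (at t ∘ (i +_)) (sym (toℕ-inject₁ a)))
                    (cong (at t) (sym (+-suc i (toℕ a))))
                    (trail-step t (≤-trans (+-monoʳ-≤ i (<⇒≤ (toℕ<n a))) i+d≤l))
    ; close     = subst₂ Adj (cong (at t ∘ (i +_)) (sym (toℕ-fromℕ d)))
                    (trans (sym eq) (cong (at t) (sym (+-identityʳ i))))
                    (trail-step t i+d≤l)
    }
    where
    vertex : Fin (3 + k) → Vertex G
    vertex a = at t (i + toℕ a)
    bound : ∀ (a : Fin (3 + k)) → i + toℕ a ≤ i + d
    bound a = +-monoʳ-≤ i (ℕ.s≤s⁻¹ (toℕ<n a))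
    distinct : ∀ {a b : Fin (3 + k)} → toℕ a < toℕ b → vertex a ≢ vertex b
    distinct {a} {b} a<b = near (+-monoʳ-< i a<b)
      (≤-trans (bound b) (+-monoˡ-≤ d (m≤m+n i (toℕ a))))
      (≤-trans (bound b) (≤-trans i+d≤l (n≤1+n l)))
    injective : Injective _≡_ _≡_ vertex
    injective {a} {b} eq with <-cmp (toℕ a) (toℕ b)
    ... | tri< a<b _ _ = contradiction eq (distinct a<b)
    ... | tri≈ _ a≡b _ = toℕ-injective a≡b
    ... | tri> _ _ b<a = contradiction (sym eq) (distinct b<a)

  -- Induction on the largest gap `d`: once all smaller gaps are excluded, an equality at the next
  -- gap joins nearest repetitions.
  trail-distinct : ¬ Graph.Cycle G → ∀ {l x y} (t : Trail l x y) d {i j} →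
                   i < j → j ≤ i + d → j ≤ suc l → at t i ≢ at t j
  trail-distinct acyclic t zero {i} {j} i<j j≤i+0 _ =
    contradiction (subst (j ≤_) (+-identityʳ i) j≤i+0) (<⇒≱ i<j)
  trail-distinct acyclic {l} t (suc d) {i} {j} i<j j≤ j≤1+l with j ≤? i + d
  ... | yes j≤i+d = trail-distinct acyclic t d i<j j≤i+d j≤1+l
  ... | no j≰i+d with ≤-antisym (subst (j ≤_) (+-suc i d) j≤) (≰⇒> j≰i+d)
  ... | refl = trail-no-return acyclic t d (trail-distinct acyclic t d) (ℕ.s≤s⁻¹ j≤1+l)

  trail-bound : ¬ Graph.Cycle G → ∀ {l x y} → Trail l x y → l < order
  trail-bound acyclic {l} t = decidable-stable (suc l ≤? order) λ l≮ →
    let a , b , a<b , eq = pigeonhole (≰⇒> l≮) (at t ∘ toℕ {suc l})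
        b≤l = ℕ.s≤s⁻¹ (toℕ<n b)
    in trail-distinct acyclic t l a<b (≤-trans b≤l (m≤n+m l (toℕ a))) (≤-trans b≤l (n≤1+n l)) eq

  HasTrail : ℕ → Set
  HasTrail l = ∃[ x ] ∃[ y ] Trail l x y

  -- By `trail-bound` the search ends within `order` rounds, so `order` is enough fuel. The form
  -- `k + l` records that the result is at least as long as the given trail.
  longest-trail : ¬ Graph.Cycle G → ∀ l → HasTrail l →
                  ∃[ k ] HasTrail (k + l) × ¬ HasTrail (suc (k + l))
  longest-trail acyclic l has = go order l has (m≤n+m order l)
    where
    go : ∀ fuel l → HasTrail l → order ≤ l + fuel →
         ∃[ k ] HasTrail (k + l) × ¬ HasTrail (suc (k + l))
    go zero    l (_ , _ , t) le =
      contradiction (subst (order ≤_) (+-identityʳ l) le) (<⇒≱ (trail-bound acyclic t))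
    go (suc f) l has le with any? (λ x → any? λ y → trail? (suc l) x y)
    ... | no ¬longer = 0 , has , ¬longer
    ... | yes longer with go f (suc l) longer (subst (order ≤_) (+-suc l f) le)
    ... | k , found , max = suc k , subst HasTrail (+-suc k l) found ,
                            max ∘ subst HasTrail (cong suc (sym (+-suc k l)))

  -- With the tree hung from `q`, every grandchild of `p` is a leaf.
  Anchor : Vertex G → Vertex G → Set
  Anchor p q = Adj p q × (∀ c y → Adj p c → c ≢ q → Adj c y → y ≢ p → Leaf y c)

  -- The end v₀, v₁, p, q of a longest path.
  record DeepEnd : Set where
    field
      {v₀ v₁ p q} : Vertex G
      v₀~v₁  : Adj v₀ v₁
      p~v₁   : Adj p v₁
      v₀≢p   : v₀ ≢ p
      v₁≢q   : v₁ ≢ q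
      anchor : Anchor p q
      above  : (∀ z → Adj q z → z ≡ p) ⊎
               (∃[ r ] Adj q r × r ≢ p × (∀ w → Adj q w → w ≢ r → Anchor w q))

  -- A branch violating an anchor condition could replace the start of the longest trail and make it
  -- longer. If the trail ends at `q`, reversing it shows that `q` is a leaf; otherwise `r` is its
  -- next vertex, and any neighbour of `q` other than `r` can take the place of `p`.
  deepEnd : ¬ Graph.Cycle G → HasTrail 2 → DeepEnd
  deepEnd acyclic has with longest-trail acyclic 2 has
  ... | k , has′ , max′ = go k (subst HasTrail (+-comm k 2) has′)
                            (max′ ∘ subst HasTrail (cong suc (+-comm 2 k)))
    where
    anchored : ∀ {k p q} → ¬ HasTrail (3 + k) → Trail k p q → Anchor p q
    anchored max t = trail-head t , λ c y p~c c≢q c~y y≢p →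
      symm c~y , λ z y~z → decidable-stable (z ≟ c) λ z≢c →
        max (z , y , cons (symm y~z) (≢-sym z≢c)
                       (cons (symm c~y) (≢-sym y≢p) (cons (symm p~c) (≢-sym c≢q) t)))
    go : ∀ k → HasTrail (2 + k) → ¬ HasTrail (3 + k) → DeepEnd
    go k (v₀ , v₁ , cons {z = p} e p≢v₀ (cons {z = q} e′ q≢v₁ t)) max = record
      { v₀~v₁ = e ; p~v₁ = symm e′ ; v₀≢p = ≢-sym p≢v₀ ; v₁≢q = ≢-sym q≢v₁
      ; anchor = anchored max t ; above = above t max }
      where
      above : ∀ {k} → Trail k p q → ¬ HasTrail (3 + k) → (∀ z → Adj q z → z ≡ p) ⊎
              (∃[ r ] Adj q r × r ≢ p × (∀ w → Adj q w → w ≢ r → Anchor w q))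
      above (edge p~q) max = inj₁ λ z q~z → decidable-stable (z ≟ p) λ z≢p →
        max (z , q , cons (symm q~z) (≢-sym z≢p)
                       (cons (symm p~q) (≢-sym q≢v₁) (cons (symm e′) (≢-sym p≢v₀) (edge (symm e)))))
      above (cons {z = r} _ r≢p t) max = inj₂ (r , trail-head t , r≢p , λ w q~w w≢r →
        anchored max (cons (symm q~w) (≢-sym w≢r) t))

-- Detaching a pendant copy from a tree

lookup-injective : ∀ {A : Set} {xs : List A} → Unique xs → Injective _≡_ _≡_ (List.lookup xs)
lookup-injective {xs = x ∷ xs} (x∉ ∷ _) {zero}  {zero}  _  = refl
lookup-injective {xs = x ∷ xs} (x∉ ∷ _) {zero}  {suc j} eq = contradiction eq (All.lookup x∉ (∈-lookup j))
lookup-injective {xs = x ∷ xs} (x∉ ∷ _) {suc i} {zero}  eq = contradiction (sym eq) (All.lookup x∉ (∈-lookup i))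
lookup-injective {xs = x ∷ xs} (_ ∷ u)  {suc i} {suc j} eq = cong suc (lookup-injective u eq)

-- A copy f of H in G that is joined to the rest of G only by the edge from f v to u.
record Pendant (G H : Graph) (u : Vertex G) (v : Vertex H) : Set where
  field
    f         : Vertex H → Vertex G
    injective : Injective _≡_ _≡_ f
    avoids    : ∀ i → f i ≢ u
    preserves : ∀ {i j} → Graph.Adj H i j → Graph.Adj G (f i) (f j)
    joined    : Graph.Adj G (f v) u
    nbrs      : ∀ i z → Graph.Adj G (f i) z → (∃[ j ] Graph.Adj H i j × f j ≡ z) ⊎ i ≡ v × z ≡ u

module Detach (T : Tree) {H : Graph} {u : Vertex (graph T)} {v : Vertex H}
              (pendant : Pendant (graph T) H u v) where
  open Pendant pendant
  private
    G = graph T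
    module G = Graph G
    n = Graph.order H

  inside? : ∀ z → Dec (∃[ i ] f i ≡ z)
  inside? z = any? λ i → f i ≟ z

  rest : List (Vertex G)
  rest = filter (¬? ∘ inside?) (allFin G.order)

  m : ℕ
  m = List.length rest

  g : Fin m → Vertex G
  g = List.lookup rest

  g-injective : Injective _≡_ _≡_ g
  g-injective = lookup-injective (filter⁺ (¬? ∘ inside?) (allFin⁺ G.order))

  f≢g : ∀ {i x} → f i ≢ g x
  f≢g {i} {x} eq = proj₂ (∈-filter⁻ (¬? ∘ inside?) {xs = allFin G.order} (∈-lookup x)) (i , eq)

  outside⇒g : ∀ {z} → (∀ i → f i ≢ z) → ∃[ x ] g x ≡ z
  outside⇒g {z} f≢z = index z∈ , sym (lookup-index z∈)
    where z∈ = ∈-filter⁺ (¬? ∘ inside?) (∈-allFin z) λ (i , eq) → f≢z i eq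

  g-or-f : ∀ z → ∃[ s ] [ g , f ]′ s ≡ z
  g-or-f z with inside? z
  ... | yes (i , eq) = inj₂ i , eq
  ... | no ¬inside   = let x , eq = outside⇒g λ i eq → ¬inside (i , eq) in inj₁ x , eq

  u′ : Fin m
  u′ = proj₁ (outside⇒g avoids)

  g-u′ : g u′ ≡ u
  g-u′ = proj₂ (outside⇒g avoids)

  restGraph : Graph
  restGraph = record
    { order  = m
    ; Adj    = λ x y → G.Adj (g x) (g y)
    ; adj?   = λ x y → G.adj? (g x) (g y)
    ; irrefl = λ x≡y → G.irrefl (cong g x≡y)
    ; symm   = G.symm
    }

  -- The retraction that collapses the whole copy onto the attachment vertex.
  contract : Vertex G → Fin m
  contract z = [ id , (λ _ → u′) ]′ (proj₁ (g-or-f z))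

  contract-g : ∀ x → contract (g x) ≡ x
  contract-g x with g-or-f (g x)
  ... | inj₁ y , eq = g-injective eq
  ... | inj₂ i , eq = contradiction eq f≢g

  -- Collapsing turns each edge into an edge or a single vertex, because an edge leaving the copy
  -- can only end in `u`. Connectedness of the rest follows.
  contract-path : ∀ {y z} → Star G.Adj y z → Star (Graph.Adj restGraph) (contract y) (contract z)
  contract-path ε        = ε
  contract-path (_◅_ {y} {z} e es) = go (g-or-f y) (g-or-f z) refl refl ◅◅ contract-path es
    where
    to-u′ : ∀ {i x} → G.Adj (f i) (g x) → x ≡ u′
    to-u′ e with nbrs _ _ e
    ... | inj₁ (_ , _ , eq) = contradiction eq f≢g
    ... | inj₂ (_ , eq)     = g-injective (trans eq (sym g-u′))
    go : (s : ∃[ s ] [ g , f ]′ s ≡ y) (t : ∃[ t ] [ g , f ]′ t ≡ z) → g-or-f y ≡ s → g-or-f z ≡ t →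
         Star (Graph.Adj restGraph) (contract y) (contract z)
    go s t s≡ t≡ rewrite s≡ | t≡ = go′ s t
      where
      go′ : (s : ∃[ s ] [ g , f ]′ s ≡ y) (t : ∃[ t ] [ g , f ]′ t ≡ z) →
            Star (Graph.Adj restGraph) ([ id , (λ _ → u′) ]′ (proj₁ s)) ([ id , (λ _ → u′) ]′ (proj₁ t))
      go′ (inj₁ x , refl) (inj₁ x′ , refl) = e ◅ ε
      go′ (inj₁ x , refl) (inj₂ i , refl)  with to-u′ (G.symm e)
      ... | refl = ε
      go′ (inj₂ i , refl) (inj₁ x , refl)  with to-u′ e
      ... | refl = ε
      go′ (inj₂ i , refl) (inj₂ j , refl)  = ε

  restTree : Tree
  restTree = record
    { graph  = restGraph
    ; isTree = record
      { nonempty  = ℕ.>-nonZero (≤-trans (s≤s z≤n) (toℕ<n u′))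
      ; connected = λ x y → subst₂ (Star (Graph.Adj restGraph)) (contract-g x) (contract-g y)
                              (contract-path (IsTree.connected (Tree.isTree T) (g x) (g y)))
      ; acyclic   = λ c → let module Cyc = Graph.Cycle c in IsTree.acyclic (Tree.isTree T) record
          { k = Cyc.k ; vertex = g ∘ Cyc.vertex ; injective = Cyc.injective ∘ g-injective
          ; step = Cyc.step ; close = Cyc.close }
      }
    }

  gf-injective : Injective _≡_ _≡_ [ g , f ]′
  gf-injective {inj₁ x} {inj₁ y} eq = cong inj₁ (g-injective eq)
  gf-injective {inj₁ x} {inj₂ i} eq = contradiction (sym eq) f≢g
  gf-injective {inj₂ i} {inj₁ x} eq = contradiction eq f≢g
  gf-injective {inj₂ i} {inj₂ j} eq = cong inj₂ (injective eq)

  gf-adj⁺ : ∀ {s t} → SumAdj restGraph H u′ v s t → G.Adj ([ g , f ]′ s) ([ g , f ]′ t)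
  gf-adj⁺ (left e)  = e
  gf-adj⁺ (right e) = preserves e
  gf-adj⁺ bridge    = subst (λ z → G.Adj z (f v)) (sym g-u′) (G.symm joined)
  gf-adj⁺ bridge′   = subst (G.Adj (f v)) (sym g-u′) joined

  gf-adj⁻ : ∀ s t → G.Adj ([ g , f ]′ s) ([ g , f ]′ t) → SumAdj restGraph H u′ v s t
  gf-adj⁻ (inj₁ x) (inj₁ y) e = left e
  gf-adj⁻ (inj₁ x) (inj₂ i) e = sumSym restGraph H u′ v (gf-adj⁻ (inj₂ i) (inj₁ x) (G.symm e))
  gf-adj⁻ (inj₂ i) (inj₁ x) e with nbrs i (g x) e
  ... | inj₁ (_ , _ , eq) = contradiction eq f≢g
  ... | inj₂ (refl , eq) with g-injective (trans eq (sym g-u′))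
  ... | refl = bridge′
  gf-adj⁻ (inj₂ i) (inj₂ j) e with nbrs i (f j) e
  ... | inj₁ (_ , e′ , eq) = right (subst (Graph.Adj H i) (injective eq) e′)
  ... | inj₂ (_ , eq)      = contradiction eq (avoids j)

  to : Fin (m + n) → Vertex G
  to = [ g , f ]′ ∘ splitAt m

  from : Vertex G → Fin (m + n)
  from = join m n ∘ proj₁ ∘ g-or-f

  to-from : ∀ z → to (from z) ≡ z
  to-from z = trans (cong [ g , f ]′ (splitAt-join m n (proj₁ (g-or-f z)))) (proj₂ (g-or-f z))

  to-injective : Injective _≡_ _≡_ to
  to-injective {x} {y} eq =
    trans (sym (join-splitAt m n x)) (trans (cong (join m n) (gf-injective {splitAt m x} {splitAt m y} eq)) (join-splitAt m n y))

  reattach : (restGraph +[ u′ , v ] H) ≅ G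
  reattach = record
    { bijection = mk↔ₛ′ to from to-from (λ y → to-injective (to-from (to y)))
    ; adj⇔      = λ x y → mk⇔ gf-adj⁺ (gf-adj⁻ (splitAt m x) (splitAt m y))
    }

  -- The measure of the final induction drops, since `v` shows that the copy is nonempty.
  m<order : m < G.order
  m<order = begin-strict
    m                                <⟨ m<m+n m (≤-trans (s≤s z≤n) (toℕ<n v)) ⟩
    m + n                            ≤⟨ injective⇒≤ to-injective ⟩
    G.order                          ∎
    where open ≤-Reasoning

  -- `S` is transported to the sum and cut into its two parts; `∈X⁺` retains the link with
  -- membership in `S`.
  record Restriction (S : Subset G.order) : Set where
    field
      {X}     : Subset m
      {Z}     : Subset n
      optimal : Optimal (restGraph +[ u′ , v ] H) (X ++ Z)
      ∈X⁺     : ∀ {x} → g x ∈ S → x ∈ X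

  restriction : ∀ {S} → Optimal G S → Restriction S
  restriction {S} o with Vec.splitAt m (preimage reattach S)
  ... | X , Z , eq = record
    { X = X ; Z = Z
    ; optimal = subst (Optimal _) eq (optimal-preimage reattach o)
    ; ∈X⁺     = λ {x} x∈ → ∈-++⁻ {p = X} {Z} (inj₁ x) (subst (x ↑ˡ n ∈_) eq
        (∈-preimage⁺ reattach (subst (_∈ S) (cong [ g , f ]′ (sym (splitAt-join m n (inj₁ x)))) x∈)))
    }

  dominated-u′ : ∀ {S} (r : Restriction S) {w} → w ∈ S → (∀ i → f i ≢ w) → G.Adj u w →
                 Dominated restGraph (Restriction.X r) u′
  dominated-u′ r w∈S f≢w e with outside⇒g f≢w
  ... | x , refl = x , Restriction.∈X⁺ r w∈S , subst (λ z → G.Adj z (g x)) (sym g-u′) e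

-- Exchange arguments at leaves

module _ {G : Graph} where
  open Graph G using (order; Adj; symm)

  -- A leaf in the cover is exchanged for its neighbour, which covers the only edge at the leaf.
  cover-leaf : ∀ {A x y} → Leaf G x y → IsVertexCover G A →
               ∃[ W ] IsVertexCover G W × y ∈ W × ∣ W ∣ ≤ ∣ A ∣
  cover-leaf {A} {x} {y} (e , only) c with c x y e
  ... | inj₂ y∈A = A , c , y∈A , ≤-refl
  ... | inj₁ x∈A = A ⊕ y - x ,
        cover-delete {G = G} (cover-⊕ {G = G} y c) (λ z e′ → subst (_∈ A ⊕ y) (sym (only z e′)) (∈-⊕ʳ A y)) ,
        x∈p∧x≢y⇒x∈p-y (∈-⊕ʳ A y) (λ { refl → Graph.irrefl G refl e }) ,
        ∣p⊕y-x∣≤∣p∣ A y x∈A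

  total-leaf : ∀ {D x y} → Leaf G x y → Total G D → y ∈ D
  total-leaf {D} {x} (_ , only) td = let z , z∈ , e = td x in subst (_∈ D) (only z e) z∈

  -- Total dominating sets may be assumed to contain p: a vertex dominating a is p or a leaf.
  Forces : Vertex G → Vertex G → Set
  Forces a p = Adj a p × (∀ z → Adj a z → z ≡ p ⊎ Leaf G z a)

  -- If `a` is dominated by a leaf `z`, exchange `z` for `p`: only `a` was adjacent to `z`, and `p`
  -- dominates `a` as well.
  forces-total : ∀ {D a p} → Forces a p → Total G D →
                 ∃[ W ] Total G W × p ∈ W × ∣ W ∣ ≤ ∣ D ∣
  forces-total {D} {a} {p} (a~p , nbrs) td with p ∈? D
  ... | yes p∈D = D , td , p∈D , ≤-refl
  ... | no p∉D with td a
  ... | z , z∈D , a~z with nbrs z a~z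
  ... | inj₁ refl = contradiction z∈D p∉D
  ... | inj₂ (_ , only) = D ⊕ p - z ,
        (λ x → dominated-delete {G = G} td⊕p λ (x~z , _ , private-z) →
          p≢z (private-z p (subst (λ y → Adj y p) (sym (only x (symm x~z))) a~p) (∈-⊕ʳ D p))) ,
        x∈p∧x≢y⇒x∈p-y (∈-⊕ʳ D p) p≢z ,
        ∣p⊕y-x∣≤∣p∣ D p z∈D
    where
    p≢z : p ≢ z
    p≢z refl = p∉D z∈D
    td⊕p : Total G (D ⊕ p)
    td⊕p x = let w , w∈ , e = td x in w , ∈-⊕ˡ w∈ , e

  -- If a leaf `z` in `D` dominates `a`, then `a` is in `D` too and, being adjacent to `p`, equals
  -- `w`. So `z` is another private neighbour of `w`, which forces `z` to be `p`.
  forces-private : ∀ {D a p w} → Forces a p → Total G D → Private G D w p →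
                   (∀ x → Private G D w x → x ≡ p) → p ∈ D
  forces-private {D} {a} {p} {w} (a~p , nbrs) td (_ , w∈D , private-w) only-p with td a
  ... | z , z∈D , a~z with nbrs z a~z
  ... | inj₁ refl = z∈D
  ... | inj₂ leaf@(z~a , only) = subst (_∈ D) (only-p z private-z) z∈D
    where
    a≡w : a ≡ w
    a≡w = private-w a (symm a~p) (total-leaf leaf td)
    private-z : Private G D w z
    private-z = subst (Adj z) a≡w z~a , w∈D , λ y z~y _ → trans (only y z~y) a≡w

-- Undoing each of the four operations

∣p++q∣≤ : ∀ {m n c k} (p : Subset m) (q : Subset n) → ∣ p ∣ ≤ k → ∣ q ∣ ≤ c → ∣ p ++ q ∣ ≤ k + c
∣p++q∣≤ p q p≤ q≤ = subst (_≤ _) (sym (∣p++q∣≡∣p∣+∣q∣ p q)) (+-mono-≤ p≤ q≤)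

Reduction : Tree → Set₁
Reduction T = ∃[ T′ ] Graph.order (graph T′) < Graph.order (graph T) × ∃ (Optimal (graph T′)) × T′ ⟶ T

module _ {T : Tree} {S : Subset (Graph.order (graph T))} (o : Optimal (graph T) S) where
  private
    G = graph T
    module G = Graph G

  -- The vertex `w` keeps `u` dominated once the path is gone, as in the other three reductions.
  reduce-O₁ : ∀ {u w} (pendant : Pendant G (P 4) u 0F) → u ∈ S →
    w ∈ S → (∀ i → Pendant.f pendant i ≢ w) → G.Adj u w → Reduction T
  reduce-O₁ pendant u∈S w∈S f≢w u~w =
    restTree , m<order , (X , oX) ,
    O₁ u′ 0F (X , optimal⇒γₜ-τ-set restGraph oX , ∈X⁺ (subst (_∈ S) (sym g-u′) u∈S)) refl reattach
    where
    open Detach T pendant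
    r = restriction o
    open Restriction r
    -- This cover contains the attached end `0F`, so it covers the bridge even when `A` omits `u`;
    -- `middle` would not.
    alternate : Subset 4
    alternate = inside ∷ outside ∷ inside ∷ outside ∷ []
    oX : Optimal restGraph X
    oX = optimal-++⁻ {X = X} {Z} optimal (total-++-size {X = X} {Z} (Optimal.total optimal) (P₄-total-low 0F))
      (dominated-u′ r w∈S f≢w u~w)
      (λ A cA → A ++ alternate ,
        cover-++⁺ cA (toWitness {a? = vertexCover? (P 4) alternate} _) (inj₂ here) ,
        ∣p++q∣≤ A alternate ≤-refl ≤-refl)
      (λ A tA → A ++ middle , total-++⁺ (inj₁ ∘ tA) (inj₁ ∘ middle-total) ,
        ∣p++q∣≤ A middle ≤-refl ≤-refl)

  -- The remaining leaf `l` puts `u` into every total dominating set and, after an exchange, into a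
  -- cover of no larger size. The removed leaf therefore costs nothing.
  reduce-O₂ : ∀ {u w l} (pendant : Pendant G (P 1) u 0F) → u ∈ S →
    w ∈ S → (∀ i → Pendant.f pendant i ≢ w) → G.Adj u w →
    (∀ i → Pendant.f pendant i ≢ l) → Leaf G l u → Reduction T
  reduce-O₂ {l = l} pendant u∈S w∈S f≢w u~w f≢l (l~u , only) =
    restTree , m<order , (X , oX) ,
    O₂ u′ (X , optimal⇒γₜ-τ-set restGraph oX , ∈X⁺ (subst (_∈ S) (sym g-u′) u∈S)) reattach
    where
    open Detach T pendant
    r = restriction o
    open Restriction r
    l′ = proj₁ (outside⇒g f≢l)
    g-l′ = proj₂ (outside⇒g f≢l)
    leaf : Leaf restGraph l′ u′
    leaf = subst₂ G.Adj (sym g-l′) (sym g-u′) l~u ,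
           λ z e → g-injective (trans (only (g z) (subst (λ y → G.Adj y (g z)) g-l′ e)) (sym g-u′))
    none : Subset 1
    none = outside ∷ []
    oX : Optimal restGraph X
    oX = optimal-++⁻ {X = X} {Z} optimal z≤n (dominated-u′ r w∈S f≢w u~w)
      (λ A cA → let W , cW , u∈W , W≤A = cover-leaf {G = restGraph} leaf cA in
        W ++ none ,
        cover-++⁺ cW (λ { 0F 0F (inj₁ ()) ; 0F 0F (inj₂ ()) }) (inj₁ u∈W) ,
        ∣p++q∣≤ W none W≤A z≤n)
      (λ A tA → A ++ none , total-++⁺ (inj₁ ∘ tA) (λ { 0F → inj₂ (refl , total-leaf {G = restGraph} leaf tA) }) ,
        ∣p++q∣≤ A none ≤-refl z≤n)

  -- The remaining vertex `a` lets total dominating sets be assumed to contain `u`, so one vertex of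
  -- the path is enough. The same vertex `a` excludes quasi-isolation through `forces-private`.
  reduce-O₃ : ∀ {u w a} (pendant : Pendant G (P 2) u 0F) → u ∈ S →
    w ∈ S → (∀ i → Pendant.f pendant i ≢ w) → G.Adj u w →
    (∀ i → Pendant.f pendant i ≢ a) → Forces {G} a u → Reduction T
  reduce-O₃ {a = a} pendant u∈S w∈S f≢w u~w f≢a (a~u , nbrs) =
    restTree , m<order , (X , oX) ,
    O₃ u′ (X , optimal⇒γₜ-τ-set restGraph oX , ∈X⁺ (subst (_∈ S) (sym g-u′) u∈S))
       (¬quasiIsolated⁺ restGraph nq) reattach
    where
    open Detach T pendant
    r = restriction o
    open Restriction r
    a′ = proj₁ (outside⇒g f≢a)
    g-a′ = proj₂ (outside⇒g f≢a)
    forces : Forces {restGraph} a′ u′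
    forces = subst₂ G.Adj (sym g-a′) (sym g-u′) a~u , λ z e →
      map⊎ (λ z≡u → g-injective (trans z≡u (sym g-u′)))
           (λ (z~a , only) → subst (G.Adj (g z)) (sym g-a′) z~a ,
                             λ y e′ → g-injective (trans (only (g y) e′) (sym g-a′)))
           (nbrs (g z) (subst (λ y → G.Adj y (g z)) g-a′ e))
    1≤Z = total-++-size {X = X} {Z} (Optimal.total optimal) P₂-total-low
    oX : Optimal restGraph X
    oX = optimal-++⁻ {X = X} {Z} optimal 1≤Z (dominated-u′ r w∈S f≢w u~w)
      (λ A cA → A ++ ⁅ 0F ⁆ , cover-++⁺ cA P₂-cover (inj₂ (x∈⁅x⁆ 0F)) ,
        ∣p++q∣≤ A ⁅ 0F ⁆ ≤-refl ≤-refl)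
      (λ A tA → let W , tW , u∈W , W≤A = forces-total {G = restGraph} forces tA in
        W ++ ⁅ 0F ⁆ , total-++⁺ (inj₁ ∘ tW) (λ y → map⊎ id (_, u∈W) (P₂-dominated y)) ,
        ∣p++q∣≤ W ⁅ 0F ⁆ W≤A ≤-refl)
    nq : NotQuasiIsolated restGraph u′
    nq = notQuasiIsolated-++⁻ optimal 1≤Z oX ≤-refl (x∈⁅x⁆ 0F) λ D w tD pu only y →
      map⊎ id (_, forces-private {G = restGraph} forces tD pu only) (P₂-dominated y)

  -- `middle` is total in itself and contains the attached vertex, so it completes any set on the
  -- rest.
  reduce-O₄ : ∀ {u w} (pendant : Pendant G (P 4) u 1F) →
    w ∈ S → (∀ i → Pendant.f pendant i ≢ w) → G.Adj u w → Reduction T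
  reduce-O₄ pendant w∈S f≢w u~w =
    restTree , m<order , (X , oX) ,
    O₄ u′ 1F (¬quasiIsolated⁺ restGraph nq) (0F , inj₂ refl , refl) reattach
    where
    open Detach T pendant
    r = restriction o
    open Restriction r
    2≤Z = total-++-size {X = X} {Z} (Optimal.total optimal) (P₄-total-low 1F)
    1∈middle : 1F ∈ middle
    1∈middle = support∈middle 1F (0F , inj₂ refl , refl)
    oX : Optimal restGraph X
    oX = optimal-++⁻ {X = X} {Z} optimal 2≤Z (dominated-u′ r w∈S f≢w u~w)
      (λ A cA → A ++ middle , cover-++⁺ cA middle-cover (inj₂ 1∈middle) ,
        ∣p++q∣≤ A middle ≤-refl ≤-refl)
      (λ A tA → A ++ middle , total-++⁺ (inj₁ ∘ tA) (inj₁ ∘ middle-total) ,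
        ∣p++q∣≤ A middle ≤-refl ≤-refl)
    nq : NotQuasiIsolated restGraph u′
    nq = notQuasiIsolated-++⁻ optimal 2≤Z oX ≤-refl 1∈middle λ _ _ _ _ _ → inj₁ ∘ middle-total

-- Recognising copies of the path on four vertices

module _ {G : Graph} where
  open Graph G using (order; Adj; symm)

  P₄-preserves : ∀ {a b c d} → Adj a b → Adj b c → Adj c d → ∀ {i j} → Graph.Adj (P 4) i j →
                 let f = lookup (a ∷ b ∷ c ∷ d ∷ []) in Adj (f i) (f j)
  P₄-preserves {a} {b} {c} {d} ab bc cd = [ forward _ _ , symm ∘ forward _ _ ]′
    where
    f = lookup (a ∷ b ∷ c ∷ d ∷ [])
    forward : ∀ i j → toℕ j ≡ suc (toℕ i) → Adj (f i) (f j)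
    forward 0F 1F refl = ab
    forward 1F 2F refl = bc
    forward 2F 3F refl = cd

  lookup₄-injective : ∀ {a b c d : Vertex G} → a ≢ b → a ≢ c → a ≢ d → b ≢ c → b ≢ d → c ≢ d →
                      Injective _≡_ _≡_ (lookup (a ∷ b ∷ c ∷ d ∷ []))
  lookup₄-injective ab ac ad bc bd cd = VecUnique.lookup-injective
    ((ab ∷ ac ∷ ad ∷ []) ∷ (bc ∷ bd ∷ []) ∷ (cd ∷ []) ∷ [] ∷ []) _ _

  -- Without neighbours outside the copy, connectivity makes the copy all of G.
  connected-copy-≅ : ∀ {H} (f : Vertex H → Vertex G) (i₀ : Vertex H) → Graph.Connected G →
    Injective _≡_ _≡_ f → (∀ {i j} → Graph.Adj H i j → Adj (f i) (f j)) →
    (∀ i z → Adj (f i) z → ∃[ j ] Graph.Adj H i j × f j ≡ z) → H ≅ G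
  connected-copy-≅ {H} f i₀ connected injective preserves nbrs = record
    { bijection = mk↔ₛ′ f (proj₁ ∘ reached) (proj₂ ∘ reached) (λ i → injective (proj₂ (reached (f i))))
    ; adj⇔      = λ i j → mk⇔ preserves (reflects i j)
    }
    where
    walk : ∀ {i z} → Star Adj (f i) z → ∃[ j ] f j ≡ z
    walk ε        = _ , refl
    walk (e ◅ es) with nbrs _ _ e
    ... | _ , _ , refl = walk es
    reached : ∀ z → ∃[ j ] f j ≡ z
    reached z = walk (connected (f i₀) z)
    reflects : ∀ i j → Adj (f i) (f j) → Graph.Adj H i j
    reflects i j e with nbrs i (f j) e
    ... | _ , e′ , eq = subst (Graph.Adj H i) (injective eq) e′

-- From a (γₜ-τ)-set to the family: analysis of a deep end

module _ {T : Tree} {S : Subset (Graph.order (graph T))} (o : Optimal (graph T) S) where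
  private
    G = graph T
    open Graph G using (order; Adj; adj?; symm)
    open Optimal o

  adj⇒≢ : ∀ {x y} → Adj x y → x ≢ y
  adj⇒≢ e x≡y = Graph.irrefl G x≡y e

  leaf? : ∀ x y → Dec (Leaf G x y)
  leaf? x y = adj? x y ×-dec all? λ z → adj? x z →-dec z ≟ y

  -- Otherwise `S - x` would be a smaller vertex cover.
  ¬nbrs⊆S : ∀ {x} → x ∈ S → ¬ (∀ z → Adj x z → z ∈ S)
  ¬nbrs⊆S x∈S nbrs = <⇒≱ (x∈p⇒∣p-x∣<∣p∣ x∈S) (cover-min _ (cover-delete {G = G} cover nbrs))

  support∈S : ∀ {x y} → Leaf G x y → y ∈ S
  support∈S leaf = total-leaf {G = G} leaf total

  leaf∉S : ∀ {x y} → Leaf G x y → x ∉ S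
  leaf∉S leaf@(_ , only) x∈S =
    ¬nbrs⊆S x∈S λ z e → subst (_∈ S) (sym (only z e)) (support∈S leaf)

  other-nbr : ∀ {x y} → ¬ Leaf G x y → Adj x y → ∃[ z ] Adj x z × z ≢ y
  other-nbr {x} {y} ¬leaf e with any? (λ z → adj? x z ×-dec ¬? (z ≟ y))
  ... | yes found = found
  ... | no none   = contradiction
    (e , λ z e′ → decidable-stable (z ≟ y) λ z≢y → none (z , e′ , z≢y)) ¬leaf

  -- `S` contains two adjacent vertices; neither is a leaf, so the edge between them extends in both
  -- directions.
  hasTrail : HasTrail G 2
  hasTrail with IsTree.nonempty (Tree.isTree T)
  ... | ne with total (fromℕ< (ℕ.>-nonZero⁻¹ order {{ne}}))
  ... | s , s∈S , _ with total s
  ... | t , t∈S , s~t with other-nbr (λ leaf → leaf∉S leaf s∈S) s~t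
                         | other-nbr (λ leaf → leaf∉S leaf t∈S) (symm s~t)
  ... | a , s~a , a≢t | b , t~b , b≢s =
    a , s , cons (symm s~a) (≢-sym a≢t) (cons s~t b≢s (edge t~b))

  reduce-twins : ∀ {x l y} → Leaf G x y → Leaf G l y → x ≢ l → Reduction T
  reduce-twins {x} {l} {y} leafₓ@(x~y , only) leafₗ x≢l with total y
  ... | w , w∈S , y~w = reduce-O₂ o pendant (support∈S leafₓ) w∈S
    (λ { 0F refl → leaf∉S leafₓ w∈S }) y~w (λ { 0F → x≢l }) leafₗ
    where
    pendant : Pendant G (P 1) y 0F
    pendant = record
      { f         = λ _ → x
      ; injective = λ { {0F} {0F} _ → refl }
      ; avoids    = λ _ → adj⇒≢ x~y
      ; preserves = λ { {0F} {0F} (inj₁ ()) ; {0F} {0F} (inj₂ ()) }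
      ; joined    = x~y
      ; nbrs      = λ { 0F z e → inj₂ (refl , only z e) }
      }

  module _ (noTwins : ∀ {x l y} → Leaf G x y → Leaf G l y → x ≡ l) where

    module _ {p q v₁ v₀} (anchor : Anchor G p q) (p~v₁ : Adj p v₁) (v₁≢q : v₁ ≢ q)
             (v₀~v₁ : Adj v₀ v₁) (v₀≢p : v₀ ≢ p) where
      private
        p~q = proj₁ anchor

      leaf-v₀ : Leaf G v₀ v₁
      leaf-v₀ = proj₂ anchor v₁ v₀ p~v₁ v₁≢q (symm v₀~v₁) v₀≢p

      -- All neighbours of `v₁` except `p` are leaves, and twins are excluded.
      nbrs-v₁ : ∀ z → Adj v₁ z → z ≡ p ⊎ z ≡ v₀
      nbrs-v₁ z e with z ≟ p
      ... | yes z≡p = inj₁ z≡p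
      ... | no z≢p  = inj₂ (noTwins (proj₂ anchor v₁ z p~v₁ v₁≢q e z≢p) leaf-v₀)

      p∈S : p ∈ S
      p∈S with total v₁
      ... | z , z∈S , e with nbrs-v₁ z e
      ... | inj₁ refl = z∈S
      ... | inj₂ refl = contradiction z∈S (leaf∉S leaf-v₀)

      v₀≁p : ¬ Adj p v₀
      v₀≁p e = adj⇒≢ p~v₁ (proj₂ leaf-v₀ p (symm e))

      ≢v₀ : ∀ {z} → Adj p z → v₀ ≢ z
      ≢v₀ e refl = v₀≁p e

      -- With `v₁` and `v₀` removed, the branch at `w` still forces `p`, because the neighbours of
      -- `w` beyond `p` are leaves; `s` keeps `p` dominated.
      reduce-P₂ : ∀ {w s} → Adj p w → w ≢ v₁ → w ≢ q → s ∈ S → Adj p s → s ≢ v₁ → Reduction T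
      reduce-P₂ {w} {s} p~w w≢v₁ w≢q s∈S p~s s≢v₁ = reduce-O₃ o pendant p∈S s∈S
        (λ { 0F → ≢-sym s≢v₁ ; 1F → ≢v₀ p~s }) p~s
        (λ { 0F → ≢-sym w≢v₁ ; 1F → ≢v₀ p~w }) (symm p~w , forced)
        where
        pendant : Pendant G (P 2) p 0F
        pendant = record
          { f         = lookup (v₁ ∷ v₀ ∷ [])
          ; injective = VecUnique.lookup-injective ((≢-sym (adj⇒≢ v₀~v₁) ∷ []) ∷ [] ∷ []) _ _
          ; avoids    = λ { 0F → ≢-sym (adj⇒≢ p~v₁) ; 1F → v₀≢p }
          ; preserves = λ { {0F} {0F} (inj₁ ()) ; {0F} {0F} (inj₂ ())
                          ; {0F} {1F} _ → symm v₀~v₁ ; {1F} {0F} _ → v₀~v₁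
                          ; {1F} {1F} (inj₁ ()) ; {1F} {1F} (inj₂ ()) }
          ; joined    = symm p~v₁
          ; nbrs      = λ where
              0F z e → [ (λ z≡p → inj₂ (refl , z≡p)) , (λ z≡v₀ → inj₁ (1F , inj₁ refl , sym z≡v₀)) ]′ (nbrs-v₁ z e)
              1F z e → inj₁ (0F , inj₂ refl , sym (proj₂ leaf-v₀ z e))
          }
        forced : ∀ z → Adj w z → z ≡ p ⊎ Leaf G z w
        forced z e with z ≟ p
        ... | yes z≡p = inj₁ z≡p
        ... | no z≢p  = inj₂ (proj₂ anchor w z p~w w≢q e z≢p)

      q≁v₁ : ¬ Adj q v₁
      q≁v₁ e with nbrs-v₁ q (symm e)
      ... | inj₁ q≡p = adj⇒≢ p~q (sym q≡p)
      ... | inj₂ q≡v₀ = ≢v₀ p~q (sym q≡v₀)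

      q≁v₀ : ¬ Adj q v₀
      q≁v₀ e = v₁≢q (sym (proj₂ leaf-v₀ q (symm e)))

      -- A further neighbour of `p` with a leaf of its own would be a support and hence in `S`. So
      -- it is a leaf, and without twins `w` is the only one. Then `q` is no leaf, and as `q` is
      -- outside `S`, its next neighbour is in `S` and dominates it.
      reduce-claw : ∀ {w} → Adj p w → w ≢ v₁ → w ≢ q →
                    (∀ s → s ∈ S → Adj p s → s ≡ v₁) → Reduction T
      reduce-claw {w} p~w w≢v₁ w≢q only-v₁ = detach (other-nbr q-not-leaf (symm p~q))
        where
        leaf-p : ∀ {z} → Adj p z → z ≢ v₁ → z ≢ q → Leaf G z p
        leaf-p {z} p~z z≢v₁ z≢q = symm p~z , λ y z~y → decidable-stable (y ≟ p) λ y≢p →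
          z≢v₁ (only-v₁ z (support∈S (proj₂ anchor z y p~z z≢q z~y y≢p)) p~z)
        leaf-w = leaf-p p~w w≢v₁ w≢q
        q-not-leaf : ¬ Leaf G q p
        q-not-leaf leaf = w≢q (noTwins leaf-w leaf)
        q∉S : q ∉ S
        q∉S q∈S = v₁≢q (sym (only-v₁ q q∈S p~q))
        nbrs-p : ∀ z → Adj p z → z ≡ v₁ ⊎ z ≡ q ⊎ z ≡ w
        nbrs-p z p~z with z ≟ v₁ | z ≟ q
        ... | yes z≡v₁ | _       = inj₁ z≡v₁
        ... | no _     | yes z≡q = inj₂ (inj₁ z≡q)
        ... | no z≢v₁  | no z≢q  = inj₂ (inj₂ (noTwins (leaf-p p~z z≢v₁ z≢q) leaf-w))
        pendant : Pendant G (P 4) q 1F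
        pendant = record
          { f         = lookup (w ∷ p ∷ v₁ ∷ v₀ ∷ [])
          ; injective = lookup₄-injective {G} (≢-sym (adj⇒≢ p~w)) w≢v₁ (≢-sym (≢v₀ p~w))
                          (adj⇒≢ p~v₁) (≢-sym v₀≢p) (≢-sym (adj⇒≢ v₀~v₁))
          ; avoids    = λ { 0F → w≢q ; 1F → adj⇒≢ p~q ; 2F → v₁≢q ; 3F → ≢v₀ p~q }
          ; preserves = P₄-preserves {G} (symm p~w) p~v₁ (symm v₀~v₁)
          ; joined    = p~q
          ; nbrs      = λ where
              0F z e → inj₁ (1F , inj₁ refl , sym (proj₂ leaf-w z e))
              1F z e → case nbrs-p z e of λ where
                (inj₁ z≡v₁)       → inj₁ (2F , inj₁ refl , sym z≡v₁)
                (inj₂ (inj₁ z≡q)) → inj₂ (refl , z≡q)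
                (inj₂ (inj₂ z≡w)) → inj₁ (0F , inj₂ refl , sym z≡w)
              2F z e → inj₁ ([ (λ z≡p → 1F , inj₂ refl , sym z≡p)
                             , (λ z≡v₀ → 3F , inj₁ refl , sym z≡v₀) ]′ (nbrs-v₁ z e))
              3F z e → inj₁ (2F , inj₂ refl , sym (proj₂ leaf-v₀ z e))
          }
        detach : ∃[ r ] Adj q r × r ≢ p → Reduction T
        detach (r , q~r , r≢p) = reduce-O₄ o pendant
          ([ (λ q∈S → contradiction q∈S q∉S) , id ]′ (cover q r q~r))
          (λ { 0F refl → adj⇒≢ p~q (sym (proj₂ leaf-w q (symm q~r)))
             ; 1F p≡r → r≢p (sym p≡r)
             ; 2F refl → q≁v₁ q~r
             ; 3F refl → q≁v₀ q~r }) q~r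

      analyse : Reduction T ⊎ (∀ z → Adj p z → z ≡ v₁ ⊎ z ≡ q)
      analyse with any? (λ w → adj? p w ×-dec ¬? (w ≟ v₁) ×-dec ¬? (w ≟ q))
      ... | no none = inj₂ nbrs-p
        where
        nbrs-p : ∀ z → Adj p z → z ≡ v₁ ⊎ z ≡ q
        nbrs-p z e with z ≟ v₁ | z ≟ q
        ... | yes z≡v₁ | _       = inj₁ z≡v₁
        ... | no _     | yes z≡q = inj₂ z≡q
        ... | no z≢v₁  | no z≢q  = contradiction (z , e , z≢v₁ , z≢q) none
      ... | yes (w , p~w , w≢v₁ , w≢q) with any? (λ s → (s ∈? S) ×-dec adj? p s ×-dec ¬? (s ≟ v₁))
      ... | yes (s , s∈S , p~s , s≢v₁) = inj₁ (reduce-P₂ p~w w≢v₁ w≢q s∈S p~s s≢v₁)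
      ... | no none = inj₁ (reduce-claw p~w w≢v₁ w≢q λ s s∈S p~s →
        decidable-stable (s ≟ v₁) λ s≢v₁ → none (s , s∈S , p~s , s≢v₁))

      module _ (nbrs-p : ∀ z → Adj p z → z ≡ v₁ ⊎ z ≡ q) where
        -- `p` and `v₁` are in `S`, so `q` must be the neighbour of `p` outside `S`.
        thin⇒q∉S : q ∉ S
        thin⇒q∉S q∈S = ¬nbrs⊆S p∈S λ z e →
          [ (λ { refl → support∈S leaf-v₀ }) , (λ { refl → q∈S }) ]′ (nbrs-p z e)

        private
          f : Fin 4 → Vertex G
          f = lookup (q ∷ p ∷ v₁ ∷ v₀ ∷ [])

          f-injective : Injective _≡_ _≡_ f
          f-injective = lookup₄-injective {G} (≢-sym (adj⇒≢ p~q)) (≢-sym v₁≢q) (≢-sym (≢v₀ p~q))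
                          (adj⇒≢ p~v₁) (≢-sym v₀≢p) (≢-sym (adj⇒≢ v₀~v₁))

          f-preserves : ∀ {i j} → Graph.Adj (P 4) i j → Adj (f i) (f j)
          f-preserves = P₄-preserves {G} (symm p~q) p~v₁ (symm v₀~v₁)

          f-nbrs : ∀ i z → Adj (f (suc i)) z → ∃[ j ] Graph.Adj (P 4) (suc i) j × f j ≡ z
          f-nbrs 0F z e = [ (λ z≡v₁ → 2F , inj₁ refl , sym z≡v₁)
                          , (λ z≡q → 0F , inj₂ refl , sym z≡q) ]′ (nbrs-p z e)
          f-nbrs 1F z e = [ (λ z≡p → 1F , inj₂ refl , sym z≡p)
                          , (λ z≡v₀ → 3F , inj₁ refl , sym z≡v₀) ]′ (nbrs-v₁ z e)
          f-nbrs 2F z e = 2F , inj₂ refl , sym (proj₂ leaf-v₀ z e)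

        P₄-whole : (∀ z → Adj q z → z ≡ p) → P 4 ≅ G
        P₄-whole only-p = connected-copy-≅ f 0F (IsTree.connected (Tree.isTree T)) f-injective f-preserves
          λ { 0F z e → 1F , inj₁ refl , sym (only-p z e) ; (suc i) → f-nbrs i }

        -- Since `q` is outside `S`, the edge to `r` puts `r` in `S`. A dominator of `r` in `S` lies
        -- off the path, where only `q` is adjacent to `r`.
        reduce-P₄ : ∀ {r} → Adj q r → r ≢ p → (∀ z → Adj q z → z ≡ p ⊎ z ≡ r) → Reduction T
        reduce-P₄ {r} q~r r≢p nbrs-q with total r
        ... | w , w∈S , r~w = reduce-O₁ o pendant r∈S w∈S f≢w r~w
          where
          r∈S : r ∈ S
          r∈S = [ (λ q∈S → contradiction q∈S thin⇒q∉S) , id ]′ (cover q r q~r)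
          f≢r : ∀ i → f i ≢ r
          f≢r 0F = adj⇒≢ q~r
          f≢r 1F = ≢-sym r≢p
          f≢r 2F refl = q≁v₁ q~r
          f≢r 3F refl = q≁v₀ q~r
          f≢w : ∀ i → f i ≢ w
          f≢w 0F refl = thin⇒q∉S w∈S
          f≢w (suc i) refl with f-nbrs i r (symm r~w)
          ... | j , _ , eq = f≢r j eq
          pendant : Pendant G (P 4) r 0F
          pendant = record
            { f         = f
            ; injective = f-injective
            ; avoids    = f≢r
            ; preserves = f-preserves
            ; joined    = q~r
            ; nbrs      = λ where
                0F z e → [ (λ z≡p → inj₁ (1F , inj₁ refl , sym z≡p)) , (λ z≡r → inj₂ (refl , z≡r)) ]′ (nbrs-q z e)
                (suc i) z e → inj₁ (f-nbrs i z e)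
            }

    -- Replacing p and w by q would give a smaller vertex cover.
    ¬two-thin : ∀ {p w q v₁ s} → p ≢ w → p ≢ s → p ∈ S → w ∈ S → v₁ ∈ S → s ∈ S → Adj p q → Adj w q →
      (∀ z → Adj p z → z ≡ v₁ ⊎ z ≡ q) → ¬ (∀ z → Adj w z → z ≡ s ⊎ z ≡ q)
    ¬two-thin {p} {w} {q} {v₁} {s} p≢w p≢s p∈S w∈S v₁∈S s∈S p~q w~q nbrs-p nbrs-w =
      <⇒≱ smaller (cover-min (S ⊕ q - p - w) (cover-delete {G = G} (cover-delete {G = G} (cover-⊕ {G = G} q cover)
        λ z e → [ (λ { refl → ∈-⊕ˡ v₁∈S }) , (λ { refl → ∈-⊕ʳ S q }) ]′ (nbrs-p z e))
        λ z e → [ (λ { refl → x∈p∧x≢y⇒x∈p-y (∈-⊕ˡ s∈S) (≢-sym p≢s) })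
                , (λ { refl → x∈p∧x≢y⇒x∈p-y (∈-⊕ʳ S q) (≢-sym (adj⇒≢ p~q)) }) ]′ (nbrs-w z e)))
      where
      open ≤-Reasoning
      smaller : ∣ S ⊕ q - p - w ∣ < ∣ S ∣
      smaller = begin-strict
        ∣ S ⊕ q - p - w ∣ <⟨ x∈p⇒∣p-x∣<∣p∣ (x∈p∧x≢y⇒x∈p-y (∈-⊕ˡ w∈S) (≢-sym p≢w)) ⟩
        ∣ S ⊕ q - p ∣     ≤⟨ ∣p⊕y-x∣≤∣p∣ S q p∈S ⟩
        ∣ S ∣             ∎

    reduce-deepEnd : DeepEnd G → Reduction T ⊎ P 4 ≅ G
    reduce-deepEnd deep with analyse anchor p~v₁ v₁≢q v₀~v₁ v₀≢p
      where open DeepEnd deep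
    ... | inj₁ reduction = inj₁ reduction
    ... | inj₂ nbrs-p with DeepEnd.above deep
    ... | inj₁ only-p = inj₂ (P₄-whole anchor p~v₁ v₁≢q v₀~v₁ v₀≢p nbrs-p only-p)
      where open DeepEnd deep
    ... | inj₂ (r , q~r , r≢p , anchors)
        with any? (λ w → adj? (DeepEnd.q deep) w ×-dec ¬? (w ≟ DeepEnd.p deep) ×-dec ¬? (w ≟ r))
    ... | no none = inj₁ (reduce-P₄ anchor p~v₁ v₁≢q v₀~v₁ v₀≢p nbrs-p q~r r≢p nbrs-q)
      where
      open DeepEnd deep
      nbrs-q : ∀ z → Adj q z → z ≡ p ⊎ z ≡ r
      nbrs-q z e with z ≟ p | z ≟ r
      ... | yes z≡p | _       = inj₁ z≡p
      ... | no _    | yes z≡r = inj₂ z≡r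
      ... | no z≢p  | no z≢r  = contradiction (z , e , z≢p , z≢r) none
    ... | yes (w , q~w , w≢p , w≢r) = second-branch (total w)
      where
      open DeepEnd deep
      q∉S = thin⇒q∉S anchor p~v₁ v₁≢q v₀~v₁ v₀≢p nbrs-p
      w∈S : w ∈ S
      w∈S = [ (λ q∈S → contradiction q∈S q∉S) , id ]′ (cover q w q~w)
      second-branch : Dominated G S w → Reduction T ⊎ P 4 ≅ G
      -- The dominator `s` of `w` is no leaf, so it has a neighbour `t` beyond `w`; now `w`, `s`,
      -- `t` play the roles of `p`, `v₁`, `v₀`.
      second-branch (s , s∈S , w~s) with other-nbr (λ leaf → leaf∉S leaf s∈S) (symm w~s)
      ... | t , s~t , t≢w with analyse (anchors w q~w w≢r) w~s (λ { refl → q∉S s∈S }) (symm s~t) t≢w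
      ... | inj₁ reduction = inj₁ reduction
      ... | inj₂ nbrs-w = ⊥-elim (¬two-thin (≢-sym w≢p) p≢s
              (p∈S anchor p~v₁ v₁≢q v₀~v₁ v₀≢p) w∈S
              (support∈S (leaf-v₀ anchor p~v₁ v₁≢q v₀~v₁ v₀≢p)) s∈S
              (proj₁ anchor) (symm q~w) nbrs-p nbrs-w)
        where
        p≢s : p ≢ s
        p≢s refl with nbrs-p w (symm w~s)
        ... | inj₁ refl = q≁v₁ anchor p~v₁ v₁≢q v₀~v₁ v₀≢p q~w
        ... | inj₂ refl = adj⇒≢ q~w refl

  reduce : Reduction T ⊎ P 4 ≅ G
  reduce with any? (λ x → any? λ l → any? λ y → leaf? x y ×-dec leaf? l y ×-dec ¬? (x ≟ l))
  ... | yes (x , l , y , leafₓ , leafₗ , x≢l) = inj₁ (reduce-twins leafₓ leafₗ x≢l)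
  ... | no none = reduce-deepEnd
    (λ {x} {l} {y} leafₓ leafₗ → decidable-stable (x ≟ l) λ x≢l → none (x , l , y , leafₓ , leafₗ , x≢l))
    (deepEnd G (IsTree.acyclic (Tree.isTree T)) hasTrail)

-- Induction on the order, and the equivalence

optimal⇒𝒯 : ∀ T → Acc _<_ (Graph.order (graph T)) → ∃ (Optimal (graph T)) → 𝒯 T
optimal⇒𝒯 T (acc smaller) (S , o) with reduce {T} o
... | inj₂ P₄≅T = T , P₄≅T , ε
... | inj₁ (T′ , lt , o′ , step) with optimal⇒𝒯 T′ (smaller lt) o′
... | T₁ , P₄≅T₁ , steps = T₁ , P₄≅T₁ , steps ◅◅ step ◅ ε

theorem11 : (T : Tree) → 𝒯 T ⇔ (∃[ S ] Isγₜ-τSet (graph T) S)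
theorem11 T = mk⇔
  (λ T∈𝒯 → let S , o = 𝒯⇒optimal T∈𝒯 in S , optimal⇒γₜ-τ-set (graph T) o)
  (λ (S , γτ) → optimal⇒𝒯 T (<-wellFounded _) (S , γₜ-τ-set⇒optimal (graph T) γτ))
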